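{- Let $1\le m\le n$ be integers and let $\alpha,\beta$ be partitions with $|\alpha|=|\beta|$, $\ell(\alpha)\le m$ and $\ell(\beta)\le n$. Suppose either that $\alpha\ne\beta$, or that $\alpha=\beta$ and $\ell(\alpha)=m$. Then there exists a sign-reversing involution on $X'_{\alpha,\beta,m-1}$, i.e. a map $\varphi\colon X'_{\alpha,\beta,m-1}\to X'_{\alpha,\beta,m-1}$ with $\varphi\circ\varphi=\mathrm{id}$ and $\operatorname{sgn}(\varphi(\chi))=-\operatorname{sgn}(\chi)$ for all $\chi\in X'_{\alpha,\beta,m-1}$.
   Context: Partitions are identified with their Young diagrams (English notation; box $(i,j)$ is in row $i$, column $j$). $\mu'$ is the conjugate (transpose) of $\mu$, $\ell(\mu)$ its number of nonzero rows, $|\mu|$ its size, and $\emptyset$ the empty partition. The rank $r(\mu)$ is the greatest integer $k\ge 0$ with $\mu_k\ge k$ (side length of the Durfee square; $r(\emptyset)=0$). The $k$-stabilization $\mu_{(k)}$ is the partition obtained from $\mu$ by adding $k$ rows of length $r(\mu)$ (inserted so that the rows remain weakly decreasing). The notation $\mu\subseteq[a]\times[b]$ means that the diagram of $\mu$ fits in a rectangle with $a$ rows and $b$ columns, i.e. $\ell(\mu)\le a$ and $\mu_1\le b$. For partitions $\nu\subseteq\alpha$, a tableau of skew shape $\alpha/\nu$ is a filling of the boxes of $\alpha$ not in $\nu$ with positive integers; it is semistandard if rows weakly increase left to right and columns strictly increase top to bottom. Its content is $(c_1,c_2,\dots)$ with $c_i$ the number of labels equal to $i$. Its reverse reading word is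 obtained by reading the rows right to left, from top to bottom. A word is lattice if for every $i\ge1$ each initial segment contains at least as many $i$'s as $(i+1)$'s. A Littlewood--Richardson tableau is a semistandard tableau whose reverse reading word is lattice. $\mathrm{LR}(\alpha/\nu,\lambda)$ denotes the set of Littlewood--Richardson tableaux of shape $\alpha/\nu$ and content $\lambda$ (empty if $\nu\not\subseteq\alpha$). For fixed $m,n$, for $0\le k\le\min\{m,n\}$ and partitions $\alpha,\beta$ with $|\alpha|=|\beta|$, define $$X'_{\alpha,\beta,k}(\mu,\nu)=\mathrm{LR}(\alpha/\nu,\mu_{(k)})\times\mathrm{LR}(\beta/\nu,(\mu')_{(k)}),\qquad X'_{\alpha,\beta,k}=\bigsqcup_{\mu,\nu:\ \mu\subseteq[m-k]\times[n-k]}X'_{\alpha,\beta,k}(\mu,\nu),$$ where $\mu,\nu$ range over partitions. The sign of $\chi\in X'_{\alpha,\beta,k}(\mu,\nu)$ is $\operatorname{sgn}(\chi)=(-1)^{|\mu|}$. -}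

module Defs where

open import Data.Integer.Base as ℤ using (ℤ; -1ℤ)
open import Data.List.Base
  using (List; []; _∷_; _++_; length; map; filter; replicate; reverse; concat; take; applyUpTo)
open import Data.List.Properties using (filter-some)
open import Data.List.Relation.Unary.All using (All)
open import Data.List.Relation.Unary.All.Properties as All using ()
open import Data.List.Relation.Unary.Any using (here)
open import Data.List.Relation.Unary.Linked using (Linked)
open import Data.List.Relation.Unary.Linked.Properties as Linked using ()
open import Data.List.Sort.InsertionSort using (insertionSort)
open import Data.List.Sort.Base using (module SortingAlgorithm)
open import Data.Nat.Base using (ℕ; zero; suc; _≤_; _<_; _≥_; _∸_; z≤n; s≤s)
open import Data.Nat.ListAction using (sum)
open import Data.Nat.Properties
  using (_≟_; _≤?_; ≤-decTotalOrder; ≤-trans; n≤1+n; m≤n⇒m≤1+n)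
open import Data.Product.Base using (_×_)
open import Function.Base using (flip)
open import Relation.Binary.Construct.Flip.EqAndOrd using (decTotalOrder)
open import Relation.Binary.PropositionalEquality.Core using (_≡_)
open import Relation.Nullary.Decidable.Core using (Dec; yes; no)
open import Relation.Nullary.Negation.Core using (contradiction)

nth : ∀ {A : Set} → A → List A → ℕ → A
nth d []       _       = d
nth d (x ∷ _)  zero    = x
nth d (_ ∷ xs) (suc i) = nth d xs i

-- The list of nonzero parts represents a partition uniquely.  Here and below
-- the side conditions are irrelevant, so that propositional equality of
-- partitions and tableaux is equality of the underlying combinatorial data.

record Partition : Set where
  constructor mkPartition
  field
    parts       : List ℕ
    .decreasing : Linked _≥_ parts
    .positive   : All (1 ≤_) parts

open Partition public using (parts)

∣_∣ : Partition → ℕ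
∣ μ ∣ = sum (parts μ)

ℓ : Partition → ℕ
ℓ μ = length (parts μ)

-- Rows and columns are indexed from 0: `part μ i` is μ_{i+1}, and it is 0 for
-- i ≥ ℓ μ.
part : Partition → ℕ → ℕ
part μ i = nth 0 (parts μ) i

_⊆_ : Partition → Partition → Set
ν ⊆ α = ∀ i → part ν i ≤ part α i

_⊆[_]×[_] : Partition → ℕ → ℕ → Set
μ ⊆[ a ]×[ b ] = ℓ μ ≤ a × part μ 0 ≤ b

-- The partition whose nonzero rows are those of the given list, in
-- decreasing order.
fromRows : List ℕ → Partition
fromRows xs = mkPartition
  (filter (1 ≤?_) (sort xs))
  (Linked.filter⁺ (1 ≤?_) (flip ≤-trans) (sort-↗ xs))
  (All.all-filter (1 ≤?_) (sort xs))
  where open SortingAlgorithm (insertionSort (decTotalOrder ≤-decTotalOrder))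

private
  length-filter-mono : ∀ {A : Set} {P Q : A → Set} (P? : ∀ x → Dec (P x)) (Q? : ∀ x → Dec (Q x)) →
                       (∀ {x} → P x → Q x) → ∀ xs → length (filter P? xs) ≤ length (filter Q? xs)
  length-filter-mono P? Q? P⇒Q []       = z≤n
  length-filter-mono P? Q? P⇒Q (x ∷ xs) with P? x | Q? x
  ... | yes _  | yes _  = s≤s (length-filter-mono P? Q? P⇒Q xs)
  ... | yes px | no ¬qx = contradiction (P⇒Q px) ¬qx
  ... | no _   | yes _  = m≤n⇒m≤1+n (length-filter-mono P? Q? P⇒Q xs)
  ... | no _   | no _   = length-filter-mono P? Q? P⇒Q xs

  rows-longer-than : ∀ xs {j} → j < nth 0 xs 0 → 1 ≤ length (filter (suc j ≤?_) xs)
  rows-longer-than (x ∷ xs) {j} j<x = filter-some (suc j ≤?_) (here j<x)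

-- μ'_{j+1} is the number of rows of μ of length at least j+1.
conjugate : Partition → Partition
conjugate μ = mkPartition
  (applyUpTo (λ j → length (filter (suc j ≤?_) (parts μ))) (part μ 0))
  (Linked.applyUpTo⁺₂ _ (part μ 0) (λ j →
    length-filter-mono (suc (suc j) ≤?_) (suc j ≤?_) (≤-trans (n≤1+n (suc j))) (parts μ)))
  (All.applyUpTo⁺₁ _ (part μ 0) (rows-longer-than (parts μ)))

-- `rankUpTo μ b` is the greatest k ≤ b with k = 0 or μ_k ≥ k.  The bound ℓ μ
-- in `rank` loses nothing, as μ_k = 0 < k for k > ℓ μ.
rankUpTo : Partition → ℕ → ℕ
rankUpTo μ zero    = 0
rankUpTo μ (suc b) with suc b ≤? part μ b
... | yes _ = suc b
... | no  _ = rankUpTo μ b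

rank : Partition → ℕ
rank μ = rankUpTo μ (ℓ μ)

stabilize : ℕ → Partition → Partition
stabilize k μ = fromRows (replicate k (rank μ) ++ parts μ)

occurrences : ℕ → List ℕ → ℕ
occurrences a w = length (filter (a ≟_) w)

-- `rows` lists the rows of the filling from top to bottom; each row lists, from
-- left to right, only the labels of the boxes of α that are not in ν.
record Tableau (α ν : Partition) : Set where
  constructor mkTableau
  field
    rows       : List (List ℕ)
    .contained : ν ⊆ α
    .shape     : map length rows ≡ applyUpTo (λ i → part α i ∸ part ν i) (ℓ α)
    .positive  : All (All (1 ≤_)) rows

open Tableau public using (rows)

Box : Partition → Partition → ℕ → ℕ → Set
Box α ν i j = part ν i ≤ j × j < part α i

-- Meaningful only for Box α ν i j.
label : ∀ {α ν} → Tableau α ν → ℕ → ℕ → ℕ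
label {ν = ν} T i j = nth 0 (nth [] (rows T) i) (j ∸ part ν i)

record Semistandard {α ν : Partition} (T : Tableau α ν) : Set where
  field
    rows-weak      : ∀ i j₁ j₂ → Box α ν i j₁ → Box α ν i j₂ →
                     j₁ < j₂ → label T i j₁ ≤ label T i j₂
    columns-strict : ∀ i₁ i₂ j → Box α ν i₁ j → Box α ν i₂ j →
                     i₁ < i₂ → label T i₁ j < label T i₂ j

reverseReadingWord : ∀ {α ν} → Tableau α ν → List ℕ
reverseReadingWord T = concat (map reverse (rows T))

HasContent : ∀ {α ν} → Tableau α ν → Partition → Set
HasContent T lam = ∀ i → occurrences (suc i) (concat (rows T)) ≡ part lam i

Lattice : List ℕ → Set
Lattice w = ∀ i → 1 ≤ i → ∀ p →
  occurrences (suc i) (take p w) ≤ occurrences i (take p w)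

record LR (α ν lam : Partition) : Set where
  constructor mkLR
  field
    tableau       : Tableau α ν
    .semistandard : Semistandard tableau
    .content      : HasContent tableau lam
    .lattice      : Lattice (reverseReadingWord tableau)

open LR public using (tableau)

-- The disjoint union over μ and ν; `left` and `right` are the two components
-- of an element of X'_{α,β,k}(μ,ν).
record X′ (m n : ℕ) (α β : Partition) (k : ℕ) : Set where
  constructor mkX′
  field
    μ ν   : Partition
    .fits : μ ⊆[ m ∸ k ]×[ n ∸ k ]
    left  : LR α ν (stabilize k μ)
    right : LR β ν (stabilize k (conjugate μ))

sgn : ∀ {m n α β k} → X′ m n α β k → ℤ
sgn χ = -1ℤ ℤ.^ ∣ X′.μ χ ∣

{-# OPTIONS --safe #-}

-- Put k = m − 1.  Then μ is empty or a single row (a).  If μ is empty, both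
-- contents are empty and ν = α = β.  If μ = (a) with a ≥ 1, the contents are
-- the hook (a,1^k) and the column (1^{a+k}).  Along the rows of a
-- Littlewood–Richardson tableau the largest label grows by at most one per
-- row, so the label m forces ℓ(α) = m and row i of the left tableau to be
-- 1 … 1 i, while each row of the right tableau has at most one box.  Hence an
-- element is determined by ν, and the rows of ν vary independently:
--   α_{i+1} − 1 ≤ ν_i ≤ α_i − 1   and   β_i − 1 ≤ ν_i ≤ β_i.
-- If α ≠ β, let i be the last row with β_i < α_i; switching ν_i between β_i
-- and β_i − 1 is always allowed, and changes |μ| = |α| − |ν| − k by one.  If
-- α = β, the only element with μ ≠ ∅ has μ = (1), and it is exchanged with
-- the one with μ = ∅.
module Submission where

open import Defs
open import Data.Empty using (⊥-elim-irr)
open import Data.Integer.Base as ℤ using (-_; -1ℤ)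
open import Data.Integer.Properties as ℤ using ()
open import Data.List.Base
  using (List; []; _∷_; _++_; [_]; length; map; filter; replicate; reverse; concat; take; applyUpTo)
open import Data.List.Membership.Propositional using (_∈_)
open import Data.List.Properties as List using ()
open import Data.List.Relation.Binary.Permutation.Propositional
  using (_↭_; ↭-refl; ↭-sym; ↭-trans; ↭⇒↭ₛ)
open import Data.List.Relation.Binary.Permutation.Propositional.Properties as ↭ using ()
open import Data.List.Relation.Binary.Pointwise using (Pointwise-≡⇒≡)
open import Data.List.Relation.Unary.All as All using (All; []; _∷_)
open import Data.List.Relation.Unary.All.Properties as All using ()
open import Data.List.Relation.Unary.AllPairs using (AllPairs; []; _∷_)
open import Data.List.Relation.Unary.AllPairs.Properties as AllPairs using ()
open import Data.List.Relation.Unary.Any using (here)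
open import Data.List.Relation.Unary.Any.Properties as Any using ()
open import Data.List.Relation.Unary.Linked using (Linked; []; [-]; _∷_)
open import Data.List.Relation.Unary.Linked.Properties as Linked using ()
open import Data.List.Relation.Unary.Sorted.TotalOrder.Properties using (↗↭↗⇒≋)
open import Data.List.Sort.Base using (module SortingAlgorithm)
open import Data.List.Sort.InsertionSort using (insertionSort)
open import Data.Nat.Base hiding (∣_-_∣)
open import Data.Nat.ListAction using (sum)
open import Data.Nat.Properties
open import Data.Product.Base using (_×_; _,_; proj₁; proj₂; Σ-syntax)
open import Data.Sum.Base using (_⊎_; inj₁; inj₂; [_,_]′)
open import Function.Base using (_∘_; id; flip; const)
open import Relation.Binary.Bundles using (DecTotalOrder)
open import Relation.Binary.Construct.Flip.EqAndOrd using (decTotalOrder)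
open import Relation.Binary.PropositionalEquality
  using (_≡_; _≢_; refl; sym; trans; cong; cong₂; subst; subst₂; module ≡-Reasoning)
open import Relation.Nullary.Decidable.Core using (yes; no; recompute)
open import Relation.Nullary.Negation.Core using (¬_; contradiction)

private
  variable
    A B : Set

-- Lists indexed with a default value.

nth-map : ∀ (f : A → B) {d} xs i → nth (f d) (map f xs) i ≡ f (nth d xs i)
nth-map f []       i       = refl
nth-map f (x ∷ xs) zero    = refl
nth-map f (x ∷ xs) (suc i) = nth-map f xs i

nth-≥ : ∀ {d : A} xs {i} → length xs ≤ i → nth d xs i ≡ d
nth-≥ []       _         = refl
nth-≥ (x ∷ xs) (s≤s len) = nth-≥ xs len

nth-applyUpTo : ∀ {d : A} f {n i} → i < n → nth d (applyUpTo f n) i ≡ f i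
nth-applyUpTo f {suc n} {zero}  _         = refl
nth-applyUpTo f {suc n} {suc i} (s≤s i<n) = nth-applyUpTo (f ∘ suc) i<n

nth-replicate : ∀ {d : A} {n x i} → i < n → nth d (replicate n x) i ≡ x
nth-replicate {n = suc n} {i = zero}  _         = refl
nth-replicate {n = suc n} {i = suc i} (s≤s i<n) = nth-replicate {n = n} i<n

nth-∷ʳ-≡ : ∀ {d : A} n {y x} → nth d (replicate n y ++ [ x ]) n ≡ x
nth-∷ʳ-≡ zero    = refl
nth-∷ʳ-≡ (suc n) = nth-∷ʳ-≡ n

nth-∷ʳ-< : ∀ {d : A} {n y x i} → i < n → nth d (replicate n y ++ [ x ]) i ≡ y
nth-∷ʳ-< {n = suc n} {i = zero}  _         = refl
nth-∷ʳ-< {n = suc n} {i = suc i} (s≤s i<n) = nth-∷ʳ-< {n = n} i<n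

nth⁺ : ∀ {P : A → Set} {d xs} → All P xs → ∀ {i} → i < length xs → P (nth d xs i)
nth⁺ (px ∷ pxs) {zero}  _         = px
nth⁺ (px ∷ pxs) {suc i} (s≤s i<n) = nth⁺ pxs i<n

nth⁻ : ∀ {P : A → Set} {d} xs → (∀ {i} → i < length xs → P (nth d xs i)) → All P xs
nth⁻ []       p = []
nth⁻ (x ∷ xs) p = p z<s ∷ nth⁻ xs (p ∘ s<s)

nth-AllPairs⁻ : ∀ {R : A → A → Set} {d} xs →
  (∀ {i j} → i < j → j < length xs → R (nth d xs i) (nth d xs j)) → AllPairs R xs
nth-AllPairs⁻ []       r = []
nth-AllPairs⁻ (x ∷ xs) r =
  nth⁻ xs (λ i<n → r z<s (s<s i<n)) ∷ nth-AllPairs⁻ xs (λ i<j j<n → r (s<s i<j) (s<s j<n))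

AllPairs-reverse⁺ : ∀ {R : A → A → Set} xs →
  AllPairs R xs → AllPairs (λ x y → R y x) (reverse xs)
AllPairs-reverse⁺ []       []           = []
AllPairs-reverse⁺ (x ∷ xs) (x~xs ∷ xs~) rewrite List.unfold-reverse x xs =
  AllPairs.++⁺ (AllPairs-reverse⁺ xs xs~) ([] ∷ [])
    (All.map (_∷ []) (↭.All-resp-↭ (↭-sym (↭.↭-reverse xs)) x~xs))

All-reverse⁺ : ∀ {P : A → Set} xs → All P xs → All P (reverse xs)
All-reverse⁺ xs = ↭.All-resp-↭ (↭-sym (↭.↭-reverse xs))

All-map-reverse⁺ : ∀ {P Q : List A → Set} → (∀ xs → P xs → Q (reverse xs)) →
  ∀ {xss} → All P xss → All Q (map reverse xss)
All-map-reverse⁺ P⇒Q pxss = All.map⁺ (All.map (λ {xs} → P⇒Q xs) pxss)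

replicate-∷ʳ : ∀ n (x : A) → replicate n x ++ [ x ] ≡ x ∷ replicate n x
replicate-∷ʳ zero    x = refl
replicate-∷ʳ (suc n) x = cong (x ∷_) (replicate-∷ʳ n x)

reverse-replicate : ∀ n (x : A) → reverse (replicate n x) ≡ replicate n x
reverse-replicate zero    x = refl
reverse-replicate (suc n) x = trans (List.unfold-reverse x (replicate n x))
  (trans (cong (_++ [ x ]) (reverse-replicate n x)) (replicate-∷ʳ n x))

reverse-∷-replicate : ∀ n (x y : A) → reverse (x ∷ replicate n y) ≡ replicate n y ++ [ x ]
reverse-∷-replicate n x y =
  trans (List.unfold-reverse x (replicate n y)) (cong (_++ [ x ]) (reverse-replicate n y))

All≡⇒replicate : ∀ {x : A} {xs} → All (_≡ x) xs → xs ≡ replicate (length xs) x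
All≡⇒replicate []           = refl
All≡⇒replicate (refl ∷ pxs) = cong (_ ∷_) (All≡⇒replicate pxs)

map-reverse-involutive : (xss : List (List A)) → map reverse (map reverse xss) ≡ xss
map-reverse-involutive []         = refl
map-reverse-involutive (xs ∷ xss) =
  cong₂ _∷_ (List.reverse-involutive xs) (map-reverse-involutive xss)

map-length-reverse : (xss : List (List A)) → map length (map reverse xss) ≡ map length xss
map-length-reverse []         = refl
map-length-reverse (xs ∷ xss) = cong₂ _∷_ (List.length-reverse xs) (map-length-reverse xss)

concat-reverse-↭ : (xss : List (List A)) → concat (map reverse xss) ↭ concat xss
concat-reverse-↭ []         = ↭-refl
concat-reverse-↭ (xs ∷ xss) = ↭.++⁺ (↭.↭-reverse xs) (concat-reverse-↭ xss)

-- Words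

occ-++ : ∀ a u v → occurrences a (u ++ v) ≡ occurrences a u + occurrences a v
occ-++ a u v = trans (cong length (List.filter-++ (a ≟_) u v)) (List.length-++ (filter (a ≟_) u))

occ-↭ : ∀ a {u v} → u ↭ v → occurrences a u ≡ occurrences a v
occ-↭ a u↭v = ↭.↭-length (↭.filter-↭ (a ≟_) u↭v)

∈⇒occ : ∀ {a u} → a ∈ u → 1 ≤ occurrences a u
∈⇒occ {a} = List.filter-some (a ≟_)

occ-∉ : ∀ {a u} → All (a ≢_) u → occurrences a u ≡ 0
occ-∉ {a} a∉u = cong length (List.filter-none (a ≟_) a∉u)

occ-∷-≢ : ∀ {a x} u → a ≢ x → occurrences a (x ∷ u) ≡ occurrences a u
occ-∷-≢ {a} u a≢x = cong length (List.filter-reject (a ≟_) {xs = u} a≢x)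

occ-∷-≡ : ∀ x u → occurrences x (x ∷ u) ≡ suc (occurrences x u)
occ-∷-≡ x u = cong length (List.filter-accept (x ≟_) {xs = u} refl)

occ-replicate : ∀ x n → occurrences x (replicate n x) ≡ n
occ-replicate x n =
  trans (cong length (List.filter-all (x ≟_) (All.replicate⁺ n refl))) (List.length-replicate n)

occ-∷ʳ-≢ : ∀ {a x} u → a ≢ x → occurrences a (u ++ [ x ]) ≡ occurrences a u
occ-∷ʳ-≢ {a} {x} u a≢x = trans (occ-++ a u [ x ])
  (trans (cong (occurrences a u +_) (occ-∷-≢ [] a≢x)) (+-identityʳ _))

occ-∷ʳ-≡ : ∀ x u → occurrences x (u ++ [ x ]) ≡ suc (occurrences x u)
occ-∷ʳ-≡ x u = trans (occ-++ x u [ x ])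
  (trans (cong (occurrences x u +_) (occ-∷-≡ x [])) (+-comm _ 1))

occ-++-≥ˡ : ∀ a u v → occurrences a u ≤ occurrences a (u ++ v)
occ-++-≥ˡ a u v = ≤-trans (m≤m+n _ _) (≤-reflexive (sym (occ-++ a u v)))

-- The lattice condition, checked prefix by prefix.

Ballot : List ℕ → Set
Ballot u = ∀ i → 1 ≤ i → occurrences (suc i) u ≤ occurrences i u

-- Here `u` has already been read. Keeping it as a parameter allows the lattice condition to be
-- handled one row at a time.
LatticeAfter : List ℕ → List ℕ → Set
LatticeAfter u w = ∀ p → Ballot (u ++ take p w)

Lattice⇒LatticeAfter : ∀ {w} → Lattice w → LatticeAfter [] w
Lattice⇒LatticeAfter lattice p i 1≤i = lattice i 1≤i p

LatticeAfter⇒Lattice : ∀ {w} → LatticeAfter [] w → Lattice w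
LatticeAfter⇒Lattice lattice i 1≤i p = lattice p i 1≤i

LatticeAfter-++⁺ : ∀ u w {v} → LatticeAfter u w → LatticeAfter (u ++ w) v → LatticeAfter u (w ++ v)
LatticeAfter-++⁺ u []      {v} _  lv p rewrite List.++-identityʳ u = lv p
LatticeAfter-++⁺ u (x ∷ w) {v} lw lv zero = lw zero
LatticeAfter-++⁺ u (x ∷ w) {v} lw lv (suc p) =
  subst Ballot (List.++-assoc u [ x ] (take p (w ++ v)))
    (LatticeAfter-++⁺ (u ++ [ x ]) w
      (λ q → subst Ballot (sym (List.++-assoc u [ x ] (take q w))) (lw (suc q)))
      (subst (λ t → LatticeAfter t v) (sym (List.++-assoc u [ x ] w)) lv) p)

LatticeAfter-++⁻ : ∀ u w {v} → LatticeAfter u (w ++ v) → LatticeAfter (u ++ w) v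
LatticeAfter-++⁻ u w {v} l p =
  subst Ballot (trans (cong (u ++_) (take-+ w)) (sym (List.++-assoc u w (take p v))))
    (l (length w + p))
  where
  take-+ : ∀ w → take (length w + p) (w ++ v) ≡ w ++ take p v
  take-+ []      = refl
  take-+ (x ∷ w) = cong (x ∷_) (take-+ w)

Fresh : ℕ → List ℕ → Set
Fresh c u = ∀ j → c < j → occurrences j u ≡ 0

Fresh-++⁺ : ∀ {c} u {v} → Fresh c u → All (_≤ c) v → Fresh c (u ++ v)
Fresh-++⁺ {c} u {v} fresh v≤c j c<j = trans (occ-++ j u v)
  (cong₂ _+_ (fresh j c<j) (occ-∉ (All.map (λ x≤c → >⇒≢ (≤-<-trans x≤c c<j)) v≤c)))

-- The prefixes of the reading words occurring here satisfy this with t = 2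
-- (content a hook) or t = 1 (content a column).
record Inv (t c : ℕ) (u : List ℕ) : Set where
  field
    used  : ∀ j → 1 ≤ j → j ≤ c → 1 ≤ occurrences j u
    fresh : Fresh c u
    once  : ∀ j → t ≤ j → occurrences j u ≤ 1

open Inv

Inv-[] : ∀ {t} → Inv t 0 []
Inv-[] .used (suc _) _ ()
Inv-[] .fresh _ _ = refl
Inv-[] .once  _ _ = z≤n

-- The ballot condition bounds only labels `suc i` ≥ 2. Up to c such a label occurs at most once and
-- its predecessor at least once; beyond c it does not occur. This is why t ≤ 2 suffices.
Inv⇒Ballot : ∀ {t c u} → t ≤ 2 → Inv t c u → Ballot u
Inv⇒Ballot {c = c} t≤2 inv i 1≤i with suc i ≤? c
... | yes i<c = ≤-trans (inv .once (suc i) (≤-trans t≤2 (s≤s 1≤i))) (inv .used i 1≤i (<⇒≤ i<c))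
... | no  i≮c = ≤-trans (≤-reflexive (inv .fresh (suc i) (≰⇒> i≮c))) z≤n

Inv-next : ∀ {t c u} → Inv t c u → Inv t (suc c) (u ++ [ suc c ])
Inv-next {t} {c} {u} inv .used j 1≤j j≤1+c with j ≟ suc c
... | yes refl = ≤-trans (s≤s z≤n) (≤-reflexive (sym (occ-∷ʳ-≡ j u)))
... | no  j≢   = ≤-trans (inv .used j 1≤j (≤-pred (≤∧≢⇒< j≤1+c j≢))) (occ-++-≥ˡ j u _)
Inv-next {t} {c} {u} inv .fresh j 1+c<j =
  trans (occ-∷ʳ-≢ u (>⇒≢ 1+c<j)) (inv .fresh j (<-trans (n<1+n c) 1+c<j))
Inv-next {t} {c} {u} inv .once j t≤j with j ≟ suc c
... | yes refl = ≤-reflexive (trans (occ-∷ʳ-≡ j u) (cong suc (inv .fresh j ≤-refl)))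
... | no  j≢   = ≤-trans (≤-reflexive (occ-∷ʳ-≢ u j≢)) (inv .once j t≤j)

-- With t = 2 the number of 1s is unrestricted, and a positive counter means that 1 is not a new
-- label.
Inv-one : ∀ {c u} → Inv 2 (suc c) u → Inv 2 (suc c) (u ++ [ 1 ])
Inv-one {c} {u} inv .used j 1≤j j≤c = ≤-trans (inv .used j 1≤j j≤c) (occ-++-≥ˡ j u _)
Inv-one {c} {u} inv .fresh = Fresh-++⁺ u (inv .fresh) (s≤s z≤n ∷ [])
Inv-one {c} {u} inv .once j 2≤j = ≤-trans (≤-reflexive (occ-∷ʳ-≢ u (>⇒≢ 2≤j))) (inv .once j 2≤j)

-- Reading `w` after any prefix that satisfies the invariant keeps the lattice condition and moves
-- the largest label from c to c′. Steps compose, so a whole reading word is treated row by row.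
Step : ℕ → ℕ → List ℕ → ℕ → Set
Step t c w c′ = ∀ u → Inv t c u → LatticeAfter u w × Inv t c′ (u ++ w)

Step-[] : ∀ {t c} → t ≤ 2 → Step t c [] c
Step-[] t≤2 u inv =
  (λ p → subst Ballot (cong (u ++_) (sym (List.take-[] p))) (Inv⇒Ballot t≤2 inv′)) , inv′
  where inv′ = subst (Inv _ _) (sym (List.++-identityʳ u)) inv

Step-[x] : ∀ {t c c′ x} → t ≤ 2 → (∀ {u} → Inv t c u → Inv t c′ (u ++ [ x ])) → Step t c [ x ] c′
Step-[x] {x = x} t≤2 next u inv = lattice , next inv
  where
  lattice : LatticeAfter u [ x ]
  lattice zero    = proj₁ (Step-[] t≤2 u inv) 0
  lattice (suc p) = subst (λ v → Ballot (u ++ x ∷ v)) (sym (List.take-[] p)) (Inv⇒Ballot t≤2 (next inv))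

Step-++ : ∀ {t a b c} w {v} → Step t a w b → Step t b v c → Step t a (w ++ v) c
Step-++ w {v} step-w step-v u inv with step-w u inv
... | lw , inv′ with step-v (u ++ w) inv′
... | lv , inv″ = LatticeAfter-++⁺ u w lw lv , subst (Inv _ _) (List.++-assoc u w v) inv″

-- Reading words of hook and column tableaux.

-- The rows are listed as they are read, that is, from right to left.
hookWords : ℕ → List ℕ → List (List ℕ)
hookWords c []       = []
hookWords c (l ∷ ls) = (suc c ∷ replicate (pred l) 1) ∷ hookWords (suc c) ls

-- Intended for lengths 0 and 1: an empty row leaves the counter alone and a single box takes the
-- next label, both of which `c + l` records.
colWords : ℕ → List ℕ → List (List ℕ)
colWords c []       = []
colWords c (l ∷ ls) = replicate l (suc c) ∷ colWords (c + l) ls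

hook-block : ∀ c n → Step 2 c (suc c ∷ replicate n 1) (suc c)
hook-block c n = Step-++ [ suc c ] (Step-[x] ≤-refl Inv-next) (ones n)
  where
  ones : ∀ n → Step 2 (suc c) (replicate n 1) (suc c)
  ones zero    = Step-[] ≤-refl
  ones (suc n) = Step-++ [ 1 ] (Step-[x] ≤-refl Inv-one) (ones n)

hookWords-step : ∀ c ls → Step 2 c (concat (hookWords c ls)) (c + length ls)
hookWords-step c []       rewrite +-identityʳ c        = Step-[] ≤-refl
hookWords-step c (l ∷ ls) rewrite +-suc c (length ls) =
  Step-++ (suc c ∷ replicate (pred l) 1) (hook-block c (pred l)) (hookWords-step (suc c) ls)

colWords-step : ∀ c {ls} → All (_≤ 1) ls → Step 1 c (concat (colWords c ls)) (c + sum ls)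
colWords-step c []                           rewrite +-identityʳ c = Step-[] (s≤s z≤n)
colWords-step c {l ∷ ls} (z≤n ∷ ls≤1)        rewrite +-identityʳ c = colWords-step c ls≤1
colWords-step c {.1 ∷ ls} (s≤s z≤n ∷ ls≤1)   rewrite +-comm c 1 | +-suc c (sum ls) =
  Step-++ [ suc c ] (Step-[x] (s≤s z≤n) Inv-next) (colWords-step (suc c) ls≤1)

hookWords-lengths : ∀ c {ls} → All (1 ≤_) ls → map length (hookWords c ls) ≡ ls
hookWords-lengths c []                      = refl
hookWords-lengths c (_∷_ {x = suc l} _ 1≤) =
  cong₂ _∷_ (cong suc (List.length-replicate l)) (hookWords-lengths (suc c) 1≤)

colWords-lengths : ∀ c ls → map length (colWords c ls) ≡ ls
colWords-lengths c []       = refl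
colWords-lengths c (l ∷ ls) = cong₂ _∷_ (List.length-replicate l) (colWords-lengths (c + l) ls)

hookWords-positive : ∀ c ls → All (All (1 ≤_)) (hookWords c ls)
hookWords-positive c []       = []
hookWords-positive c (l ∷ ls) =
  (s≤s z≤n ∷ All.replicate⁺ (pred l) ≤-refl) ∷ hookWords-positive (suc c) ls

colWords-positive : ∀ c ls → All (All (1 ≤_)) (colWords c ls)
colWords-positive c []       = []
colWords-positive c (l ∷ ls) = All.replicate⁺ l (s≤s z≤n) ∷ colWords-positive (c + l) ls

nth-hookWords : ∀ c ls {i} → i < length ls →
  nth [] (hookWords c ls) i ≡ suc (c + i) ∷ replicate (pred (nth 0 ls i)) 1
nth-hookWords c (l ∷ ls) {zero}  _         rewrite +-identityʳ c = refl
nth-hookWords c (l ∷ ls) {suc i} (s≤s i<n) rewrite +-suc c i     = nth-hookWords (suc c) ls i<n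

-- Once the counter is positive, every row has exactly one label greater than 1, so the 1s fall
-- short of the boxes by one per row.
hookWords-ones : ∀ c {ls} → All (1 ≤_) ls →
  occurrences 1 (concat (hookWords (suc c) ls)) + length ls ≡ sum ls
hookWords-ones c []                               = refl
hookWords-ones c {suc l ∷ ls} (_ ∷ 1≤) = begin
  occurrences 1 (suc (suc c) ∷ w ++ v) + suc (length ls)
    ≡⟨ cong (_+ suc (length ls)) (occ-∷-≢ {1} {suc (suc c)} (w ++ v) (λ ())) ⟩
  occurrences 1 (w ++ v) + suc (length ls)
    ≡⟨ cong (_+ suc (length ls)) (occ-++ 1 w v) ⟩
  occurrences 1 w + occurrences 1 v + suc (length ls)
    ≡⟨ cong (λ n → n + occurrences 1 v + suc (length ls)) (occ-replicate 1 l) ⟩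
  l + occurrences 1 v + suc (length ls)
    ≡⟨ +-suc (l + occurrences 1 v) (length ls) ⟩
  suc (l + occurrences 1 v + length ls)
    ≡⟨ cong suc (+-assoc l _ _) ⟩
  suc (l + (occurrences 1 v + length ls))
    ≡⟨ cong (λ n → suc (l + n)) (hookWords-ones (suc c) 1≤) ⟩
  suc (l + sum ls) ∎
  where
  open ≡-Reasoning
  w = replicate l 1
  v = concat (hookWords (suc (suc c)) ls)

-- In the first row the new label is itself a 1, so only the k later rows have a label other than 1.
hookWords-ones₀ : ∀ {k ls} → All (1 ≤_) ls → length ls ≡ suc k →
  occurrences 1 (concat (hookWords 0 ls)) + k ≡ sum ls
hookWords-ones₀ {k} {suc l ∷ ls} (_ ∷ 1≤) refl = begin
  occurrences 1 (1 ∷ w ++ v) + k              ≡⟨ cong (_+ k) (occ-∷-≡ 1 (w ++ v)) ⟩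
  suc (occurrences 1 (w ++ v)) + k            ≡⟨ cong (λ n → suc n + k) (occ-++ 1 w v) ⟩
  suc (occurrences 1 w + occurrences 1 v) + k ≡⟨ cong (λ n → suc (n + occurrences 1 v) + k) (occ-replicate 1 l) ⟩
  suc (l + occurrences 1 v) + k               ≡⟨ cong suc (+-assoc l _ k) ⟩
  suc (l + (occurrences 1 v + k))             ≡⟨ cong (λ n → suc (l + n)) (hookWords-ones 0 1≤) ⟩
  suc (l + sum ls)                            ∎
  where
  open ≡-Reasoning
  w = replicate l 1
  v = concat (hookWords 1 ls)

nth-colWords-> : ∀ c ls i q → q < nth 0 ls i → c < nth 0 (nth [] (colWords c ls) i) q
nth-colWords-> c (l ∷ ls) zero    q q<l = ≤-reflexive (sym (nth-replicate q<l))
nth-colWords-> c (l ∷ ls) (suc i) q q<l = ≤-<-trans (m≤m+n c l) (nth-colWords-> (c + l) ls i q q<l)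

-- Row `i₁` has a box, so the counter has reached its label before row `i₂` is filled. Columns need
-- this only for boxes one below the other.
nth-colWords-< : ∀ c ls {i₁ i₂ q₁ q₂} → i₁ < i₂ → q₁ < nth 0 ls i₁ → q₂ < nth 0 ls i₂ →
  nth 0 (nth [] (colWords c ls) i₁) q₁ < nth 0 (nth [] (colWords c ls) i₂) q₂
nth-colWords-< c (l ∷ ls) {zero} {suc i₂} {q₁} {q₂} _ q₁<l q₂<l = ≤-<-trans
  (≤-trans (≤-reflexive (nth-replicate q₁<l))
    (≤-trans (≤-reflexive (+-comm 1 c)) (+-monoʳ-≤ c (≤-trans (s≤s z≤n) q₁<l))))
  (nth-colWords-> (c + l) ls i₂ q₂ q₂<l)
nth-colWords-< c (l ∷ ls) {suc i₁} {suc i₂} (s≤s i₁<i₂) = nth-colWords-< (c + l) ls i₁<i₂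


-- Words forced by the lattice condition and the content.

-- If x exceeded c + 1, its predecessor would not have been read yet, and the ballot condition would
-- fail right after x.
next-label : ∀ {c} u {x w} → Fresh c u → LatticeAfter u (x ∷ w) → 1 ≤ x → x ≤ suc c
next-label u {suc zero} _ _ _ = s≤s z≤n
next-label {c} u {x@(suc y@(suc _))} {w} fresh lattice _ with y ≤? c
... | yes y≤c = s≤s y≤c
... | no  y≰c = contradiction
  (≤-trans (≤-reflexive (sym (occ-∷ʳ-≡ x u)))
    (≤-trans (lattice 1 y (s≤s z≤n))
      (≤-reflexive (trans (occ-∷ʳ-≢ u (<⇒≢ (n<1+n y))) (fresh y (≰⇒> y≰c))))))
  (λ 1+n≤0 → n≮0 1+n≤0)

repeated : ∀ {y} u {v} → 1 ≤ occurrences y u → y ∈ v → ¬ occurrences y (u ++ v) ≤ 1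
repeated {y} u {v} 1≤u y∈v =
  <⇒≱ (≤-trans (+-mono-≤ 1≤u (∈⇒occ y∈v)) (≤-reflexive (sym (occ-++ y u v))))

-- The first label read in a row is at most c + 1 by `next-label`, and labels up to c may not be
-- used again, so it is c + 1. A second box in the row would carry a label at most c + 1, which is
-- again a repetition.
colWords-unique : ∀ ss {c} u → Inv 1 c u → All (AllPairs _≥_) ss → All (All (1 ≤_)) ss →
  LatticeAfter u (concat ss) → (∀ j → 1 ≤ j → occurrences j (u ++ concat ss) ≤ 1) →
  ss ≡ colWords c (map length ss) × All (_≤ 1) (map length ss)
colWords-unique [] u _ _ _ _ _ = refl , []
colWords-unique ([] ∷ ss) {c} u inv (_ ∷ dec) (_ ∷ pos) lattice once
  with colWords-unique ss u inv dec pos lattice once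
... | eq , ≤1 = cong ([] ∷_) (trans eq (cong (λ n → colWords n (map length ss)) (sym (+-identityʳ c)))) , z≤n ∷ ≤1
colWords-unique ((x ∷ s) ∷ ss) {c} u inv ((x≥s ∷ _) ∷ dec) ((1≤x ∷ 1≤s) ∷ pos) lattice once
  with x ≤? c
... | yes x≤c = contradiction (once x 1≤x) (repeated u (inv .used x 1≤x x≤c) (here refl))
... | no  x≰c with ≤-antisym (next-label u (inv .fresh) lattice 1≤x) (≰⇒> x≰c)
colWords-unique ((x ∷ []) ∷ ss) {c} u inv (_ ∷ dec) (_ ∷ pos) lattice once | no _ | refl
  with colWords-unique ss (u ++ [ x ]) (Inv-next inv) dec pos (LatticeAfter-++⁻ u [ x ] lattice)
         (subst (λ w → ∀ j → 1 ≤ j → occurrences j w ≤ 1) (sym (List.++-assoc u [ x ] (concat ss))) once)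
... | eq , ≤1 = cong ([ x ] ∷_) (trans eq (cong (λ n → colWords n (map length ss)) (+-comm 1 c))) , ≤-refl ∷ ≤1
colWords-unique ((x ∷ y ∷ s) ∷ ss) {c} u inv (((x≥y ∷ _) ∷ _) ∷ _) ((_ ∷ 1≤y ∷ _) ∷ _) _ once | no _ | refl =
  contradiction
    (subst (λ w → occurrences y w ≤ 1) (sym (List.++-assoc u [ x ] _)) (once y 1≤y))
    (repeated (u ++ [ x ]) (Inv-next inv .used y 1≤y x≥y) (here refl))

-- The first label read in a row is the largest of that row and exceeds the previous maximum by at
-- most one, so each row raises the maximum by at most one.
max-label : ∀ ss {c} u {d} → Fresh c u → All (AllPairs _≥_) ss → All (All (1 ≤_)) ss →
  LatticeAfter u (concat ss) → 1 ≤ occurrences d (u ++ concat ss) → d ≤ c + length ss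
max-label [] {c} u {d} fresh _ _ _ 1≤d with d ≤? c
... | yes d≤c = ≤-trans d≤c (m≤m+n c 0)
... | no  d≰c rewrite List.++-identityʳ u = contradiction (subst (1 ≤_) (fresh d (≰⇒> d≰c)) 1≤d) (λ ())
max-label ([] ∷ ss) {c} u fresh (_ ∷ dec) (_ ∷ pos) lattice 1≤d =
  ≤-trans (max-label ss u fresh dec pos lattice 1≤d) (+-monoʳ-≤ c (n≤1+n _))
max-label (s@(x ∷ s′) ∷ ss) {c} u {d} fresh ((x≥s ∷ _) ∷ dec) ((1≤x ∷ _) ∷ pos) lattice 1≤d =
  ≤-trans
    (max-label ss (u ++ s) (Fresh-++⁺ u {s} fresh′ (All.map (λ y≤x → ≤-trans y≤x x≤1+c) (≤-refl ∷ x≥s)))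
      dec pos (LatticeAfter-++⁻ u s lattice)
      (subst (λ w → 1 ≤ occurrences d w) (sym (List.++-assoc u s (concat ss))) 1≤d))
    (≤-reflexive (sym (+-suc c (length ss))))
  where
  x≤1+c  = next-label u fresh lattice 1≤x
  fresh′ : Fresh (suc c) u
  fresh′ j 1+c<j = fresh j (<-trans (n<1+n c) 1+c<j)

-- The label `c + length ss` can occur only if every row raises the maximum, so each row is read
-- starting with the next new label. Its other labels are at most that label, and those from 2 on
-- may not repeat, so they are all 1.
hookWords-unique : ∀ ss {c} u → Inv 2 c u → All (AllPairs _≥_) ss → All (All (1 ≤_)) ss →
  LatticeAfter u (concat ss) → (∀ j → 2 ≤ j → occurrences j (u ++ concat ss) ≤ 1) →
  1 ≤ occurrences (c + length ss) (u ++ concat ss) →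
  ss ≡ hookWords c (map length ss) × All (1 ≤_) (map length ss)
hookWords-unique [] u _ _ _ _ _ _ = refl , []
hookWords-unique ([] ∷ ss) {c} u inv (_ ∷ dec) (_ ∷ pos) lattice _ 1≤max =
  contradiction (max-label ss u (inv .fresh) dec pos lattice 1≤max)
    (<⇒≱ (+-monoʳ-< c (n<1+n (length ss))))
hookWords-unique (s@(x ∷ s′) ∷ ss) {c} u inv ((x≥s ∷ _) ∷ dec) ((1≤x ∷ 1≤s) ∷ pos) lattice once 1≤max
  with x ≤? c
-- This row would leave the maximum at c, and the remaining rows are too few to reach the required
-- label.
... | yes x≤c = contradiction
  (max-label ss (u ++ s) (Fresh-++⁺ u {s} (inv .fresh) (All.map (λ y≤x → ≤-trans y≤x x≤c) (≤-refl ∷ x≥s)))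
    dec pos (LatticeAfter-++⁻ u s lattice)
    (subst (λ w → 1 ≤ occurrences (c + suc (length ss)) w) (sym (List.++-assoc u s (concat ss))) 1≤max))
  (<⇒≱ (+-monoʳ-< c (n<1+n (length ss))))
... | no  x≰c with ≤-antisym (next-label u (inv .fresh) lattice 1≤x) (≰⇒> x≰c)
... | refl = cong₂ _∷_ (cong (x ∷_) s′≡) (proj₁ rest) , s≤s z≤n ∷ proj₂ rest
  where
  y≡1 : ∀ {y} → y ∈ s′ → y ≡ 1
  y≡1 {y} y∈s′ with 2 ≤? y
  ... | no  2≰y = ≤-antisym (≤-pred (≰⇒> 2≰y)) (All.lookup 1≤s y∈s′)
  ... | yes 2≤y = contradiction
    (subst (λ w → occurrences y w ≤ 1) (sym (List.++-assoc u [ x ] _)) (once y 2≤y))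
    (repeated (u ++ [ x ]) (Inv-next inv .used y (All.lookup 1≤s y∈s′) (All.lookup x≥s y∈s′))
      (Any.++⁺ˡ y∈s′))
  s′≡ : s′ ≡ replicate (length s′) 1
  s′≡ = All≡⇒replicate (All.tabulate y≡1)
  assoc : (u ++ s) ++ concat ss ≡ u ++ s ++ concat ss
  assoc = List.++-assoc u s (concat ss)
  rest : ss ≡ hookWords (suc c) (map length ss) × All (1 ≤_) (map length ss)
  rest = hookWords-unique ss (u ++ s)
    (subst (λ v → Inv 2 (suc c) (u ++ x ∷ v)) (sym s′≡) (proj₂ (hook-block c (length s′) u inv)))
    dec pos (LatticeAfter-++⁻ u s lattice)
    (subst (λ w → ∀ j → 2 ≤ j → occurrences j w ≤ 1) (sym assoc) once)
    (subst₂ (λ n w → 1 ≤ occurrences n w) (+-suc c (length ss)) (sym assoc) 1≤max)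

-- Partitions

Partition-≡ : ∀ {μ ν} → parts μ ≡ parts ν → μ ≡ ν
Partition-≡ {mkPartition _ _ _} {mkPartition _ _ _} refl = refl

-- Positive entries cannot be confused with the default 0, so the values of `nth` determine the
-- length as well.
nth-injective : ∀ {xs ys} → All (1 ≤_) xs → All (1 ≤_) ys →
  (∀ i → nth 0 xs i ≡ nth 0 ys i) → xs ≡ ys
nth-injective []         []         _  = refl
nth-injective []         (1≤y ∷ _)  eq = contradiction (eq 0) (<⇒≢ 1≤y)
nth-injective (1≤x ∷ _)  []         eq = contradiction (eq 0) (>⇒≢ 1≤x)
nth-injective (1≤x ∷ xs) (1≤y ∷ ys) eq = cong₂ _∷_ (eq 0) (nth-injective xs ys (eq ∘ suc))

part-injective : ∀ {μ ν} → (∀ i → part μ i ≡ part ν i) → μ ≡ ν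
part-injective {mkPartition xs _ 1≤xs} {mkPartition ys _ 1≤ys} eq =
  -- Positivity is available only irrelevantly; decidability of the equality makes its proof
  -- relevant again. The same device is used for inequalities below.
  Partition-≡ (recompute (List.≡-dec _≟_ xs ys) (nth-injective 1≤xs 1≤ys eq))

part-pos : ∀ μ {i} → i < ℓ μ → 1 ≤ part μ i
part-pos (mkPartition _ _ 1≤xs) i<ℓ = recompute (1 ≤? _) (nth⁺ 1≤xs i<ℓ)

part-≥ℓ : ∀ μ {i} → ℓ μ ≤ i → part μ i ≡ 0
part-≥ℓ μ = nth-≥ (parts μ)

part-suc-≤ : ∀ μ i → part μ (suc i) ≤ part μ i
part-suc-≤ (mkPartition xs dec _) i = recompute (_ ≤? _) (nth-dec dec i)
  where
  nth-dec : ∀ {xs} → Linked _≥_ xs → ∀ i → nth 0 xs (suc i) ≤ nth 0 xs i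
  nth-dec []        i       = z≤n
  nth-dec [-]       i       = z≤n
  nth-dec (x≥y ∷ _) zero    = x≥y
  nth-dec (_ ∷ dec) (suc i) = nth-dec dec i

part-antitone : ∀ μ {i j} → i ≤ j → part μ j ≤ part μ i
part-antitone μ {i} i≤j = go (≤⇒≤′ i≤j)
  where
  go : ∀ {j} → i ≤′ j → part μ j ≤ part μ i
  go ≤′-refl             = ≤-refl
  go (≤′-step {n = j} p) = ≤-trans (part-suc-≤ μ j) (go p)

-- Row lengths and sizes of skew shapes.

sum-∸ : ∀ xs ys → (∀ i → nth 0 ys i ≤ nth 0 xs i) →
  sum (applyUpTo (λ i → nth 0 xs i ∸ nth 0 ys i) (length xs)) + sum ys ≡ sum xs
sum-∸ []       []       _ = refl
-- Past the end of the outer list the default 0 forces the remaining inner entries to vanish.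
sum-∸ []       (y ∷ ys) ≤xs rewrite n≤0⇒n≡0 (≤xs 0) = sum-∸ [] ys (≤xs ∘ suc)
sum-∸ (x ∷ xs) []       _ = begin
  x + sum (applyUpTo (nth 0 xs) (length xs)) + 0   ≡⟨ +-assoc x _ 0 ⟩
  x + (sum (applyUpTo (nth 0 xs) (length xs)) + 0) ≡⟨ cong (x +_) (sum-∸ xs [] (λ _ → z≤n)) ⟩
  x + sum xs                                       ∎
  where open ≡-Reasoning
sum-∸ (x ∷ xs) (y ∷ ys) ≤xs = begin
  x ∸ y + s + (y + sum ys)   ≡⟨ +-assoc (x ∸ y) s _ ⟩
  x ∸ y + (s + (y + sum ys)) ≡⟨ cong (x ∸ y +_) (trans (sym (+-assoc s y _)) (trans (cong (_+ sum ys) (+-comm s y)) (+-assoc y s _))) ⟩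
  x ∸ y + (y + (s + sum ys)) ≡⟨ +-assoc (x ∸ y) y _ ⟨
  x ∸ y + y + (s + sum ys)   ≡⟨ cong₂ _+_ (m∸n+n≡m (≤xs 0)) (sum-∸ xs ys (≤xs ∘ suc)) ⟩
  x + sum xs                 ∎
  where
  open ≡-Reasoning
  s = sum (applyUpTo (λ i → nth 0 xs i ∸ nth 0 ys i) (length xs))

-- This is the list that the field `shape` of a tableau prescribes.
rowLengths : Partition → Partition → List ℕ
rowLengths α ν = applyUpTo (λ i → part α i ∸ part ν i) (ℓ α)

length-rowLengths : ∀ α ν → length (rowLengths α ν) ≡ ℓ α
length-rowLengths α ν = List.length-applyUpTo _ (ℓ α)

nth-rowLengths : ∀ α ν i → nth 0 (rowLengths α ν) i ≡ part α i ∸ part ν i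
nth-rowLengths α ν i with i <? ℓ α
... | yes i<ℓ = nth-applyUpTo _ i<ℓ
... | no  i≮ℓ = trans
  (nth-≥ (rowLengths α ν) (≤-trans (≤-reflexive (length-rowLengths α ν)) (≮⇒≥ i≮ℓ)))
  (sym (trans (cong (_∸ part ν i) (part-≥ℓ α (≮⇒≥ i≮ℓ))) (0∸n≡0 (part ν i))))

sum-rowLengths : ∀ α ν → ν ⊆ α → sum (rowLengths α ν) + ∣ ν ∣ ≡ ∣ α ∣
sum-rowLengths α ν = sum-∸ (parts α) (parts ν)

sum≡0⇒All : ∀ {xs} → sum xs ≡ 0 → All (_≡ 0) xs
sum≡0⇒All {[]}     _  = []
sum≡0⇒All {x ∷ xs} eq = m+n≡0⇒m≡0 x eq ∷ sum≡0⇒All (m+n≡0⇒n≡0 x eq)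

rowLengths-empty : ∀ α ν → ν ⊆ α → sum (rowLengths α ν) ≡ 0 → ν ≡ α
rowLengths-empty α ν ν⊆α sum≡0 = part-injective λ i → ≤-antisym (ν⊆α i) (α≤ν i)
  where
  α≤ν : α ⊆ ν
  α≤ν i with i <? ℓ α
  ... | yes i<ℓ = m∸n≡0⇒m≤n (All.applyUpTo⁻ _ (ℓ α) (sum≡0⇒All sum≡0) i<ℓ)
  ... | no  i≮ℓ = ≤-trans (≤-reflexive (part-≥ℓ α (≮⇒≥ i≮ℓ))) z≤n

-- Stabilization

module ≥-sort = SortingAlgorithm (insertionSort (decTotalOrder ≤-decTotalOrder))

-- A weakly decreasing list is determined by its multiset of entries, so the result of sorting is
-- known without running the sort.
fromRows-parts : ∀ {xs ys} → Linked _≥_ xs → All (1 ≤_) xs → ys ↭ xs → parts (fromRows ys) ≡ xs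
fromRows-parts {xs} {ys} dec 1≤xs ys↭xs = begin
  filter (1 ≤?_) (≥-sort.sort ys) ≡⟨ cong (filter (1 ≤?_)) sorted ⟩
  filter (1 ≤?_) xs               ≡⟨ List.filter-all (1 ≤?_) 1≤xs ⟩
  xs                              ∎
  where
  open ≡-Reasoning
  sorted : ≥-sort.sort ys ≡ xs
  sorted = Pointwise-≡⇒≡ (↗↭↗⇒≋ (DecTotalOrder.totalOrder (decTotalOrder ≤-decTotalOrder))
    (≥-sort.sort-↗ ys) dec (↭⇒↭ₛ (↭-trans (≥-sort.sort-↭ ys) ys↭xs)))

fromRows-zeros : ∀ {ys} → All (_≡ 0) ys → parts (fromRows ys) ≡ []
fromRows-zeros {ys} ≡0 = List.filter-none (1 ≤?_)
  (All.map (λ { refl () }) (↭.All-resp-↭ (↭-sym (≥-sort.sort-↭ ys)) ≡0))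

replicate-Linked : ∀ n (x : ℕ) → Linked _≥_ (replicate n x)
replicate-Linked zero          x = []
replicate-Linked (suc zero)    x = [-]
replicate-Linked (suc (suc n)) x = ≤-refl ∷ replicate-Linked (suc n) x

∷-replicate-Linked : ∀ {x y} n → y ≤ x → Linked _≥_ (x ∷ replicate n y)
∷-replicate-Linked zero    _   = [-]
∷-replicate-Linked (suc n) y≤x = y≤x ∷ replicate-Linked (suc n) _

applyUpTo-const : ∀ {f : ℕ → A} {x} n → (∀ {i} → i < n → f i ≡ x) → applyUpTo f n ≡ replicate n x
applyUpTo-const zero    _  = refl
applyUpTo-const (suc n) eq = cong₂ _∷_ (eq z<s) (applyUpTo-const n (eq ∘ s<s))

-- The rank is 0, so the k added rows have length 0 and disappear.
stabilize-∅ : ∀ k μ → parts μ ≡ [] → parts (stabilize k μ) ≡ []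
stabilize-∅ k (mkPartition .[] _ _) refl =
  fromRows-zeros (All.++⁺ (All.replicate⁺ k refl) [])

-- A nonempty row has rank 1, so k rows of length 1 are added below it, giving a hook.
stabilize-row : ∀ k μ {a} → parts μ ≡ [ suc a ] → parts (stabilize k μ) ≡ suc a ∷ replicate k 1
stabilize-row k (mkPartition .([ suc a ]) _ _) {a} refl =
  fromRows-parts (∷-replicate-Linked k (s≤s z≤n)) (s≤s z≤n ∷ All.replicate⁺ k ≤-refl)
    (↭.++-comm (replicate k 1) [ suc a ])

conjugate-∅ : ∀ μ → parts μ ≡ [] → parts (conjugate μ) ≡ []
conjugate-∅ (mkPartition .[] _ _) refl = refl

conjugate-row : ∀ μ {a} → parts μ ≡ [ a ] → parts (conjugate μ) ≡ replicate a 1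
conjugate-row (mkPartition .([ a ]) _ _) {a} refl = applyUpTo-const a λ {i} i<a →
  cong length (List.filter-accept (suc i ≤?_) {xs = []} i<a)

-- All rows have length at most 1, so below the first none reaches its own index and the search
-- descends to 1.
rankUpTo-column : ∀ μ {a} → parts μ ≡ replicate (suc a) 1 → ∀ b → rankUpTo μ (suc b) ≡ 1
rankUpTo-column (mkPartition _ _ _) refl zero = refl
rankUpTo-column μ {a} eq (suc b) with suc (suc b) ≤? part μ (suc b)
... | no  _ = rankUpTo-column μ eq b
... | yes p = contradiction (≤-trans p part≤1) (<⇒≱ (s≤s (s≤s z≤n)))
  where
  part≤1 : part μ (suc b) ≤ 1
  part≤1 = ≤-trans (part-antitone μ {0} z≤n) (≤-reflexive (cong (λ xs → nth 0 xs 0) eq))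

rank-column : ∀ μ {a} → parts μ ≡ replicate (suc a) 1 → rank μ ≡ 1
rank-column μ {a} eq =
  trans (cong (rankUpTo μ) (trans (cong length eq) (List.length-replicate (suc a))))
    (rankUpTo-column μ eq a)

stabilize-column : ∀ k μ {a} → parts μ ≡ replicate (suc a) 1 →
  parts (stabilize k μ) ≡ replicate (suc a + k) 1
stabilize-column k μ {a} eq = begin
  parts (fromRows (replicate k (rank μ) ++ parts μ))
    ≡⟨ cong₂ (λ r xs → parts (fromRows (replicate k r ++ xs))) (rank-column μ eq) eq ⟩
  parts (fromRows (replicate k 1 ++ replicate (suc a) 1))
    ≡⟨ cong (parts ∘ fromRows) (replicate-++ k (suc a)) ⟩
  parts (fromRows (replicate (k + suc a) 1))
    ≡⟨ cong (λ n → parts (fromRows (replicate n 1))) (+-comm k (suc a)) ⟩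
  parts (fromRows (replicate (suc a + k) 1))
    ≡⟨ fromRows-parts (replicate-Linked (suc a + k) 1) (All.replicate⁺ (suc a + k) ≤-refl) ↭-refl ⟩
  replicate (suc a + k) 1 ∎
  where
  open ≡-Reasoning
  replicate-++ : ∀ m n → replicate m 1 ++ replicate n 1 ≡ replicate (m + n) 1
  replicate-++ zero    n = refl
  replicate-++ (suc m) n = cong (1 ∷_) (replicate-++ m n)

-- Littlewood–Richardson tableaux whose content is a column or a hook

module _ {α ν : Partition} (T : Tableau α ν) where

  occ-reading : ∀ a → occurrences a (reverseReadingWord T) ≡ occurrences a (concat (rows T))
  occ-reading a = occ-↭ a (concat-reverse-↭ (rows T))

  -- The proof fields of a tableau are irrelevant. The arguments therefore take relevant copies of
  -- them, and the decidable conclusions are later transferred to actual tableaux by `recompute`.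
  module _ (shape : map length (rows T) ≡ rowLengths α ν) where

    reading-lengths : map length (map reverse (rows T)) ≡ rowLengths α ν
    reading-lengths = trans (map-length-reverse (rows T)) shape

    reading-weak : Semistandard T → All (AllPairs _≥_) (map reverse (rows T))
    reading-weak ss = All-map-reverse⁺ AllPairs-reverse⁺ (nth⁻ {d = []} (rows T)
      λ {i} _ → nth-AllPairs⁻ {R = _≤_} {0} (nth [] (rows T) i) (row-weak i))
      where
      row-length : ∀ i → length (nth [] (rows T) i) ≡ part α i ∸ part ν i
      row-length i = trans (sym (nth-map length (rows T) i))
        (trans (cong (λ ls → nth 0 ls i) shape) (nth-rowLengths α ν i))
      box : ∀ i {q} → q < length (nth [] (rows T) i) → Box α ν i (part ν i + q)
      box i {q} q<l = m≤m+n (part ν i) q ,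
        ≤-trans (+-monoʳ-< (part ν i) (subst (q <_) (row-length i) q<l))
          (≤-reflexive (m+[n∸m]≡n {part ν i} (<⇒≤ (m∸n≢0⇒n<m {part α i} λ eq → n≮0 (subst (q <_) (trans (row-length i) eq) q<l)))))
      row-weak : ∀ i {p q} → p < q → q < length (nth [] (rows T) i) →
        nth 0 (nth [] (rows T) i) p ≤ nth 0 (nth [] (rows T) i) q
      row-weak i {p} {q} p<q q<l =
        subst₂ (λ p q → nth 0 (nth [] (rows T) i) p ≤ nth 0 (nth [] (rows T) i) q)
          (m+n∸m≡n (part ν i) p) (m+n∸m≡n (part ν i) q)
          (Semistandard.rows-weak ss i _ _ (box i (<-trans p<q q<l)) (box i q<l) (+-monoʳ-< (part ν i) p<q))

map-reverse-injective : ∀ {xss yss : List (List A)} → map reverse xss ≡ yss → xss ≡ map reverse yss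
map-reverse-injective {xss = xss} eq = trans (sym (map-reverse-involutive xss)) (cong (map reverse) eq)

nth-ones-< : ∀ {p i} → i < p → nth 0 (replicate p 1) i ≡ 1
nth-ones-< {p} = nth-replicate {n = p}

nth-ones-≥ : ∀ {p i} → p ≤ i → nth 0 (replicate p 1) i ≡ 0
nth-ones-≥ {p} p≤i = nth-≥ (replicate p 1) (≤-trans (≤-reflexive (List.length-replicate p)) p≤i)

nth-ones-≤1 : ∀ p i → nth 0 (replicate p 1) i ≤ 1
nth-ones-≤1 p i with i <? p
... | yes i<p = ≤-reflexive (nth-ones-< i<p)
... | no  i≮p = ≤-trans (≤-reflexive (nth-ones-≥ (≮⇒≥ i≮p))) z≤n

-- Up to the label t + c, `used` and `once` leave exactly one occurrence, and beyond it `fresh`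
-- leaves none. The case t = 0 yields a column, and t = 1 the part of a hook below its first row.
Inv⇒content : ∀ {c u} t → Inv (suc t) (t + c) u →
  ∀ i → occurrences (suc (t + i)) u ≡ nth 0 (replicate c 1) i
Inv⇒content {c} t inv i with i <? c
... | yes i<c = trans
  (≤-antisym (inv .once _ (s≤s (m≤m+n t i)))
    (inv .used _ (s≤s z≤n) (≤-trans (≤-reflexive (sym (+-suc t i))) (+-monoʳ-≤ t i<c))))
  (sym (nth-ones-< i<c))
... | no  i≮c = trans (inv .fresh _ (s≤s (+-monoʳ-≤ t (≮⇒≥ i≮c)))) (sym (nth-ones-≥ (≮⇒≥ i≮c)))

replicate-injective : ∀ {p q} → (∀ i → nth 0 (replicate p 1) i ≡ nth 0 (replicate q 1) i) → p ≡ q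
replicate-injective {p} {q} eq = trans (sym (List.length-replicate p))
  (trans (cong length (nth-injective (All.replicate⁺ p ≤-refl) (All.replicate⁺ q ≤-refl) eq))
    (List.length-replicate q))

reverse-colWords : ∀ c ls → map reverse (colWords c ls) ≡ colWords c ls
reverse-colWords c []       = refl
reverse-colWords c (l ∷ ls) = cong₂ _∷_ (reverse-replicate l (suc c)) (reverse-colWords (c + l) ls)

module _ {β ν lam : Partition} {p : ℕ} (lam≡ : parts lam ≡ replicate p 1) where

  -- In content 1^p no label repeats, so `colWords-unique` determines the filling and bounds each
  -- row by one box: β/ν is a vertical strip. Comparing contents then gives its size. The case p = 0
  -- covers the empty content.
  column-facts : (T : Tableau β ν) → map length (rows T) ≡ rowLengths β ν → All (All (1 ≤_)) (rows T) →
    Semistandard T → HasContent T lam → Lattice (reverseReadingWord T) →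
    rows T ≡ colWords 0 (rowLengths β ν) × (∀ j → part β j ≤ suc (part ν j)) × sum (rowLengths β ν) ≡ p
  column-facts T shape pos ss content lattice =
    trans (map-reverse-injective words≡) (reverse-colWords 0 ls) , strip , replicate-injective λ i →
      trans (sym (Inv⇒content 0 inv i)) (content′ i)
    where
    ls = rowLengths β ν
    ws = map reverse (rows T)
    content′ : ∀ i → occurrences (suc i) (concat ws) ≡ nth 0 (replicate p 1) i
    content′ i = trans (occ-reading T (suc i)) (trans (content i) (cong (λ xs → nth 0 xs i) lam≡))
    once′ : ∀ j → 1 ≤ j → occurrences j (concat ws) ≤ 1
    once′ (suc i) _ = ≤-trans (≤-reflexive (content′ i)) (nth-ones-≤1 p i)
    unique = colWords-unique ws [] Inv-[] (reading-weak T shape ss) (All-map-reverse⁺ All-reverse⁺ pos)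
      (Lattice⇒LatticeAfter lattice) once′
    words≡ : ws ≡ colWords 0 ls
    words≡ = trans (proj₁ unique) (cong (colWords 0) (reading-lengths T shape))
    ls≤1 : All (_≤ 1) ls
    ls≤1 = subst (All (_≤ 1)) (reading-lengths T shape) (proj₂ unique)
    inv : Inv 1 (sum ls) (concat ws)
    inv = subst (λ ws → Inv 1 (sum ls) (concat ws)) (sym words≡) (proj₂ (colWords-step 0 ls≤1 [] Inv-[]))
    strip : ∀ j → part β j ≤ suc (part ν j)
    strip j with j <? ℓ β
    ... | yes j<ℓ = m∸n≤o⇒m≤o+n (All.applyUpTo⁻ _ (ℓ β) ls≤1 j<ℓ)
      where
      m∸n≤o⇒m≤o+n : ∀ {m n} → m ∸ n ≤ 1 → m ≤ suc n
      m∸n≤o⇒m≤o+n {m} {n} m∸n≤1 = ≤-trans (m≤n+m∸n m n) (≤-trans (+-monoʳ-≤ n m∸n≤1) (≤-reflexive (+-comm n 1)))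
    ... | no  j≮ℓ = ≤-trans (≤-reflexive (part-≥ℓ β (≮⇒≥ j≮ℓ))) z≤n

  columnLR-rows : (T : LR β ν lam) → rows (tableau T) ≡ colWords 0 (rowLengths β ν)
  columnLR-rows (mkLR (mkTableau _ c s p) ss co la) =
    recompute (List.≡-dec (List.≡-dec _≟_) _ _) (proj₁ (column-facts (mkTableau _ c s p) s p ss co la))

  columnLR-strip : LR β ν lam → ∀ j → part β j ≤ suc (part ν j)
  columnLR-strip (mkLR (mkTableau _ c s p) ss co la) j =
    recompute (_ ≤? _) (proj₁ (proj₂ (column-facts (mkTableau _ c s p) s p ss co la)) j)

  columnLR-size : LR β ν lam → sum (rowLengths β ν) ≡ p
  columnLR-size (mkLR (mkTableau _ c s p) ss co la) =
    recompute (_ ≟ _) (proj₂ (proj₂ (column-facts (mkTableau _ c s p) s p ss co la)))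

LR-contained : ∀ {α ν lam} → LR α ν lam → ν ⊆ α
LR-contained (mkLR (mkTableau _ c _ _) _ _ _) i = recompute (_ ≤? _) (c i)

vertical⇒rowLengths≤1 : ∀ β ν → (∀ j → part β j ≤ suc (part ν j)) → All (_≤ 1) (rowLengths β ν)
vertical⇒rowLengths≤1 β ν strip = All.applyUpTo⁺₂ _ (ℓ β) λ i →
  ≤-trans (∸-monoˡ-≤ (part ν i) (strip i)) (≤-reflexive (m+n∸n≡m 1 (part ν i)))

module _ {β ν lam : Partition} (ν⊆β : ν ⊆ β) (strip : ∀ j → part β j ≤ suc (part ν j))
         (lam≡ : parts lam ≡ replicate (sum (rowLengths β ν)) 1) where

  private
    ls = rowLengths β ν

    T : Tableau β ν
    T = mkTableau (colWords 0 ls) ν⊆β (colWords-lengths 0 ls) (colWords-positive 0 ls)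

    reading : reverseReadingWord T ≡ concat (colWords 0 ls)
    reading = cong concat (reverse-colWords 0 ls)

    step = colWords-step 0 (vertical⇒rowLengths≤1 β ν strip) [] Inv-[]

    offset : ∀ {i j} → Box β ν i j → j ∸ part ν i < nth 0 ls i
    offset {i} (ν≤j , j<β) = subst (_ <_) (sym (nth-rowLengths β ν i)) (∸-monoˡ-< j<β ν≤j)

  columnLR : LR β ν lam
  columnLR = mkLR T
    (record
      -- A vertical strip has no two boxes in one row, so this case is void.
      { rows-weak = λ { i j₁ j₂ (ν≤j₁ , _) (_ , j₂<β) j₁<j₂ →
          contradiction (<-≤-trans j₂<β (≤-trans (strip i) (s≤s ν≤j₁))) (≤⇒≯ j₁<j₂) }
      ; columns-strict = λ i₁ i₂ j box₁ box₂ i₁<i₂ →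
          nth-colWords-< 0 ls i₁<i₂ (offset box₁) (offset box₂) })
    (λ i → trans (Inv⇒content 0 (proj₂ step) i) (sym (cong (λ xs → nth 0 xs i) lam≡)))
    (subst Lattice (sym reading) (LatticeAfter⇒Lattice (proj₁ step)))

-- Every nonzero row of α keeps a box outside ν, and without the last boxes of its rows α is a
-- horizontal strip over ν. Below the last row of α the use of `pred` demands ν_j = 0.
Horizontal : Partition → Partition → Set
Horizontal α ν = ∀ j → part ν j ≤ pred (part α j) × part α (suc j) ≤ suc (part ν j)

horizontal⇒1≤rowLengths : ∀ α ν → Horizontal α ν → All (1 ≤_) (rowLengths α ν)
horizontal⇒1≤rowLengths α ν horizontal = All.applyUpTo⁺₁ _ (ℓ α) λ {i} i<ℓ → m<n⇒0<n∸m
  (≤-<-trans (proj₁ (horizontal i)) (≤-reflexive (suc-pred _ {{>-nonZero (part-pos α i<ℓ)}})))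

hookRow : ∀ ls {i} → i < length ls →
  nth [] (map reverse (hookWords 0 ls)) i ≡ replicate (pred (nth 0 ls i)) 1 ++ [ suc i ]
hookRow ls {i} i<n = trans (nth-map reverse (hookWords 0 ls) i)
  (trans (cong reverse (nth-hookWords 0 ls i<n)) (reverse-∷-replicate (pred (nth 0 ls i)) (suc i) 1))

module _ {α ν : Partition} (T : Tableau α ν)
         (rows≡ : rows T ≡ map reverse (hookWords 0 (rowLengths α ν))) where

  private
    row : ∀ {i} → i < ℓ α → nth [] (rows T) i ≡ replicate (pred (part α i ∸ part ν i)) 1 ++ [ suc i ]
    row {i} i<ℓ = trans (cong (λ rs → nth [] rs i) rows≡)
      (trans (hookRow (rowLengths α ν) (subst (i <_) (sym (length-rowLengths α ν)) i<ℓ))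
        (cong (λ l → replicate (pred l) 1 ++ [ suc i ]) (nth-rowLengths α ν i)))

  Box⇒<ℓ : ∀ {i j} → Box α ν i j → i < ℓ α
  Box⇒<ℓ {i} {j} (_ , j<α) with i <? ℓ α
  ... | yes i<ℓ = i<ℓ
  ... | no  i≮ℓ = contradiction (subst (j <_) (part-≥ℓ α (≮⇒≥ i≮ℓ)) j<α) n≮0

  hook-label-inner : ∀ {i j} → Box α ν i j → suc j < part α i → label T i j ≡ 1
  hook-label-inner {i} {j} box@(ν≤j , _) 1+j<α = trans (cong (λ r → nth 0 r (j ∸ part ν i)) (row (Box⇒<ℓ box)))
    (nth-∷ʳ-< {n = pred (part α i ∸ part ν i)} (pred-mono-≤
      (subst (_≤ part α i ∸ part ν i) (+-∸-assoc 2 ν≤j) (∸-monoˡ-≤ (part ν i) 1+j<α))))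

  hook-label-last : ∀ {i j} → Box α ν i j → suc j ≡ part α i → label T i j ≡ suc i
  hook-label-last {i} {j} box@(ν≤j , _) 1+j≡α = trans (cong (λ r → nth 0 r (j ∸ part ν i)) (row (Box⇒<ℓ box)))
    (trans (cong (nth 0 (replicate n 1 ++ [ suc i ])) offset) (nth-∷ʳ-≡ n))
    where
    n = pred (part α i ∸ part ν i)
    offset : j ∸ part ν i ≡ n
    offset = cong pred (trans (sym (+-∸-assoc 1 ν≤j)) (cong (_∸ part ν i) 1+j≡α))

  hook-label-bounds : ∀ {i j} → Box α ν i j → 1 ≤ label T i j × label T i j ≤ suc i
  hook-label-bounds {i} {j} box@(_ , j<α) with m≤n⇒m<n∨m≡n j<α
  ... | inj₁ 1+j<α rewrite hook-label-inner box 1+j<α = ≤-refl , s≤s z≤n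
  ... | inj₂ 1+j≡α rewrite hook-label-last box 1+j≡α = s≤s z≤n , ≤-refl

module _ {k a : ℕ} {α ν lam : Partition} (lam≡ : parts lam ≡ suc a ∷ replicate k 1) where

  -- The label k + 1 occurs, which by `max-label` takes k + 1 rows. With ℓ(α) at most k + 1 this is
  -- an equality, and `hookWords-unique` then determines the filling.
  hook-facts : ℓ α ≤ suc k → (T : Tableau α ν) → ν ⊆ α →
    map length (rows T) ≡ rowLengths α ν → All (All (1 ≤_)) (rows T) →
    Semistandard T → HasContent T lam → Lattice (reverseReadingWord T) →
    rows T ≡ map reverse (hookWords 0 (rowLengths α ν)) × Horizontal α ν ×
    ℓ α ≡ suc k × suc a + k ≡ sum (rowLengths α ν)
  hook-facts ℓ≤ T ν⊆α shape pos ss content lattice =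
    rows≡ , (λ j → strict j , horizontal j) , ℓ≡ , size
    where
    ls = rowLengths α ν
    ws = map reverse (rows T)
    content′ : ∀ i → occurrences (suc i) (concat ws) ≡ nth 0 (suc a ∷ replicate k 1) i
    content′ i = trans (occ-reading T (suc i)) (trans (content i) (cong (λ xs → nth 0 xs i) lam≡))
    once′ : ∀ j → 2 ≤ j → occurrences j (concat ws) ≤ 1
    once′ (suc (suc i)) _ = ≤-trans (≤-reflexive (content′ (suc i))) (nth-ones-≤1 k i)
    once′ (suc zero)    (s≤s ())
    1≤last : 1 ≤ occurrences (suc k) (concat ws)
    1≤last = ≤-trans (go k) (≤-reflexive (sym (content′ k)))
      where
      go : ∀ k → 1 ≤ nth 0 (suc a ∷ replicate k 1) k
      go zero    = s≤s z≤n
      go (suc k) = ≤-reflexive (sym (nth-ones-< (n<1+n k)))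
    weak = reading-weak T shape ss
    pos′ = All-map-reverse⁺ All-reverse⁺ pos
    after = Lattice⇒LatticeAfter lattice
    length≡ : length ws ≡ ℓ α
    length≡ = trans (sym (List.length-map length ws))
      (trans (cong length (reading-lengths T shape)) (length-rowLengths α ν))
    ℓ≡ : ℓ α ≡ suc k
    ℓ≡ = ≤-antisym ℓ≤ (subst (suc k ≤_) length≡
      (max-label ws [] (λ _ _ → refl) weak pos′ after 1≤last))
    unique = hookWords-unique ws [] Inv-[] weak pos′ after once′
      (subst (λ n → 1 ≤ occurrences n (concat ws)) (sym (trans length≡ ℓ≡)) 1≤last)
    words≡ : ws ≡ hookWords 0 ls
    words≡ = trans (proj₁ unique) (cong (hookWords 0) (reading-lengths T shape))
    rows≡ = map-reverse-injective words≡
    1≤ls : All (1 ≤_) ls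
    1≤ls = subst (All (1 ≤_)) (reading-lengths T shape) (proj₂ unique)
    size : suc a + k ≡ sum ls
    size = trans (cong (_+ k) (sym (trans (cong (occurrences 1 ∘ concat) (sym words≡)) (content′ 0))))
      (hookWords-ones₀ 1≤ls (trans (length-rowLengths α ν) ℓ≡))
    strict : ∀ j → part ν j ≤ pred (part α j)
    strict j with j <? ℓ α
    ... | yes j<ℓ = pred-mono-≤ (m∸n≢0⇒n<m (>⇒≢ (All.applyUpTo⁻ _ (ℓ α) 1≤ls j<ℓ)))
    ... | no  j≮ℓ = ≤-trans (ν⊆α j) (≤-trans (≤-reflexive (part-≥ℓ α (≮⇒≥ j≮ℓ))) z≤n)
    horizontal : ∀ j → part α (suc j) ≤ suc (part ν j)
    horizontal j with part α (suc j) ≤? suc (part ν j)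
    ... | yes p = p
    -- Under the leftmost box of row j there would be a box that is not the last of its row and so
    -- carries 1, but no positive label above it can be smaller.
    ... | no ¬p = contradiction
      (Semistandard.columns-strict ss j (suc j) (part ν j) above below (n<1+n j))
      (≤⇒≯ (≤-trans (≤-reflexive (hook-label-inner T rows≡ below (≰⇒> ¬p)))
        (proj₁ (hook-label-bounds T rows≡ above))))
      where
      ν<α : part ν j < part α (suc j)
      ν<α = <-trans (n<1+n _) (≰⇒> ¬p)
      above : Box α ν j (part ν j)
      above = ≤-refl , <-≤-trans ν<α (part-suc-≤ α j)
      below : Box α ν (suc j) (part ν j)
      below = part-suc-≤ ν j , ν<α

  module _ (ℓ≤ : ℓ α ≤ suc k) where

    hookLR-rows : (T : LR α ν lam) → rows (tableau T) ≡ map reverse (hookWords 0 (rowLengths α ν))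
    hookLR-rows (mkLR (mkTableau _ c s p) ss co la) =
      recompute (List.≡-dec (List.≡-dec _≟_) _ _) (proj₁ (hook-facts ℓ≤ (mkTableau _ c s p) c s p ss co la))

    hookLR-horizontal : LR α ν lam → Horizontal α ν
    hookLR-horizontal (mkLR (mkTableau _ c s p) ss co la) j =
        recompute (_ ≤? _) (proj₁ (proj₁ (proj₂ (hook-facts ℓ≤ (mkTableau _ c s p) c s p ss co la)) j))
      , recompute (_ ≤? _) (proj₂ (proj₁ (proj₂ (hook-facts ℓ≤ (mkTableau _ c s p) c s p ss co la)) j))

    hookLR-ℓ : LR α ν lam → ℓ α ≡ suc k
    hookLR-ℓ (mkLR (mkTableau _ c s p) ss co la) =
      recompute (_ ≟ _) (proj₁ (proj₂ (proj₂ (hook-facts ℓ≤ (mkTableau _ c s p) c s p ss co la))))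

    hookLR-size : LR α ν lam → suc a + k ≡ sum (rowLengths α ν)
    hookLR-size (mkLR (mkTableau _ c s p) ss co la) =
      recompute (_ ≟ _) (proj₂ (proj₂ (proj₂ (hook-facts ℓ≤ (mkTableau _ c s p) c s p ss co la))))

  module _ (ℓ≡ : ℓ α ≡ suc k) (horizontal : Horizontal α ν)
           (size : suc a + k ≡ sum (rowLengths α ν)) where

    private
      ls = rowLengths α ν

      1≤ls = horizontal⇒1≤rowLengths α ν horizontal

      T : Tableau α ν
      T = mkTableau (map reverse (hookWords 0 ls))
        (λ i → ≤-trans (proj₁ (horizontal i)) pred[n]≤n)
        (trans (map-length-reverse (hookWords 0 ls)) (hookWords-lengths 0 1≤ls))
        (All-map-reverse⁺ All-reverse⁺ (hookWords-positive 0 ls))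

      reading : reverseReadingWord T ≡ concat (hookWords 0 ls)
      reading = cong concat (map-reverse-involutive (hookWords 0 ls))

      step = hookWords-step 0 ls [] Inv-[]

      inv : Inv 2 (suc k) (reverseReadingWord T)
      inv = subst₂ (Inv 2) (trans (length-rowLengths α ν) ℓ≡) (sym reading) (proj₂ step)

      content : ∀ i → occurrences (suc i) (reverseReadingWord T) ≡ nth 0 (suc a ∷ replicate k 1) i
      content zero    = +-cancelʳ-≡ k _ (suc a)
        (trans (cong (λ w → occurrences 1 w + k) reading)
          (trans (hookWords-ones₀ 1≤ls (trans (length-rowLengths α ν) ℓ≡)) (sym size)))
      content (suc i) = Inv⇒content 1 inv i

      rows-weak : ∀ i j₁ j₂ → Box α ν i j₁ → Box α ν i j₂ → j₁ < j₂ → label T i j₁ ≤ label T i j₂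
      rows-weak i j₁ j₂ box₁ box₂ j₁<j₂ = ≤-trans
        (≤-reflexive (hook-label-inner T refl box₁ (≤-trans (s≤s j₁<j₂) (proj₂ box₂))))
        (proj₁ (hook-label-bounds T refl box₂))

      columns-strict : ∀ i₁ i₂ j → Box α ν i₁ j → Box α ν i₂ j → i₁ < i₂ → label T i₁ j < label T i₂ j
      columns-strict i₁ (suc i₂) j box₁ box₂ (s≤s i₁≤i₂) with m≤n⇒m<n∨m≡n (proj₂ box₂)
      -- The last box of a row carries the row number, while labels in higher rows are bounded by
      -- their smaller row numbers.
      ... | inj₂ 1+j≡α = ≤-trans (s≤s (≤-trans (proj₂ (hook-label-bounds T refl box₁)) (s≤s i₁≤i₂)))
        (≤-reflexive (sym (hook-label-last T refl box₂ 1+j≡α)))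
      -- Any other box has only boxes of ν above it, by the horizontal strip condition.
      ... | inj₁ 1+j<α = contradiction
        (≤-trans 1+j<α (≤-trans (proj₂ (horizontal i₂)) (s≤s (part-antitone ν i₁≤i₂))))
        (≤⇒≯ (s≤s (proj₁ box₁)))

    hookLR : LR α ν lam
    hookLR = mkLR T
      (record { rows-weak = rows-weak ; columns-strict = columns-strict })
      (λ i → trans (sym (occ-reading T (suc i))) (trans (content i) (sym (cong (λ xs → nth 0 xs i) lam≡))))
      (subst Lattice (sym reading) (LatticeAfter⇒Lattice (proj₁ step)))

-- Elements of `X′`, and counting boxes.

open X′

X′-≡ : ∀ {m n α β k} {χ χ′ : X′ m n α β k} → μ χ ≡ μ χ′ → ν χ ≡ ν χ′ →
  rows (tableau (left χ)) ≡ rows (tableau (left χ′)) →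
  rows (tableau (right χ)) ≡ rows (tableau (right χ′)) → χ ≡ χ′
X′-≡ {χ = mkX′ _ _ _ (mkLR (mkTableau _ _ _ _) _ _ _) (mkLR (mkTableau _ _ _ _) _ _ _)}
     {χ′ = mkX′ _ _ _ (mkLR (mkTableau _ _ _ _) _ _ _) (mkLR (mkTableau _ _ _ _) _ _ _)}
     refl refl refl refl = refl

single-row : ∀ μ → .(ℓ μ ≤ 1) → parts μ ≡ [] ⊎ Σ[ a ∈ ℕ ] parts μ ≡ [ suc a ]
single-row (mkPartition []              _ _) _  = inj₁ refl
single-row (mkPartition (zero ∷ [])     _ p) _  = ⊥-elim-irr (n≮0 (All.head p))
single-row (mkPartition (suc a ∷ [])    _ _) _  = inj₂ (a , refl)
single-row (mkPartition (_ ∷ _ ∷ _)     _ _) ℓ≤ = ⊥-elim-irr (n≮0 (≤-pred ℓ≤))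

length≤sum : ∀ {xs} → All (1 ≤_) xs → length xs ≤ sum xs
length≤sum []          = z≤n
length≤sum (1≤x ∷ 1≤) = +-mono-≤ 1≤x (length≤sum 1≤)

sum≤length : ∀ {xs} → All (_≤ 1) xs → sum xs ≤ length xs
sum≤length []          = z≤n
sum≤length (x≤1 ∷ ≤1) = +-mono-≤ x≤1 (sum≤length ≤1)

sum-zeros : ∀ {f : ℕ → ℕ} n → (∀ j → f j ≡ 0) → sum (applyUpTo f n) ≡ 0
sum-zeros zero    _  = refl
sum-zeros (suc n) ≡0 = cong₂ _+_ (≡0 0) (sum-zeros n (≡0 ∘ suc))

sum-indicator : ∀ {f : ℕ → ℕ} {n i} → i < n → f i ≡ 1 → (∀ j → j ≢ i → f j ≡ 0) → sum (applyUpTo f n) ≡ 1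
sum-indicator {n = suc n} {zero}  _         ≡1 ≡0 = cong₂ _+_ ≡1 (sum-zeros n (λ j → ≡0 (suc j) λ ()))
sum-indicator {n = suc n} {suc i} (s≤s i<n) ≡1 ≡0 =
  cong₂ _+_ (≡0 0 λ ()) (sum-indicator i<n ≡1 (λ j j≢i → ≡0 (suc j) (j≢i ∘ suc-injective)))

-- The skew shape ν′/ν consists of a single box, in row i.
size-suc : ∀ ν ν′ i → part ν′ i ≡ suc (part ν i) → (∀ j → j ≢ i → part ν′ j ≡ part ν j) → ∣ ν′ ∣ ≡ suc ∣ ν ∣
size-suc ν ν′ i at off = trans (sym (sum-rowLengths ν′ ν ν⊆ν′))
  (cong (_+ ∣ ν ∣) (sum-indicator i<ℓ
    (trans (cong (_∸ part ν i) at) (m+n∸n≡m 1 (part ν i)))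
    (λ j j≢i → m≤n⇒m∸n≡0 (≤-reflexive (off j j≢i)))))
  where
  ν⊆ν′ : ν ⊆ ν′
  ν⊆ν′ j with j ≟ i
  ... | yes refl = ≤-trans (n≤1+n _) (≤-reflexive (sym at))
  ... | no  j≢i  = ≤-reflexive (sym (off j j≢i))
  i<ℓ : i < ℓ ν′
  i<ℓ with i <? ℓ ν′
  ... | yes p = p
  ... | no ¬p = contradiction (trans (sym (part-≥ℓ ν′ (≮⇒≥ ¬p))) at) λ ()

-- Partitions with prescribed row lengths.

fromParts : (f : ℕ → ℕ) → ℕ → .(∀ j → f (suc j) ≤ f j) → Partition
fromParts f n dec = mkPartition
  (filter (1 ≤?_) (applyUpTo f n))
  (Linked.filter⁺ (1 ≤?_) (flip ≤-trans) (Linked.applyUpTo⁺₂ f n dec))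
  (All.all-filter (1 ≤?_) (applyUpTo f n))

-- As f is weakly decreasing, its zeros form a tail. Filtering therefore only truncates the list,
-- and f n = 0 settles the indices from n on.
part-fromParts : ∀ {f n} (dec : ∀ j → f (suc j) ≤ f j) → f n ≡ 0 → ∀ j → part (fromParts f n dec) j ≡ f j
part-fromParts = go _ _
  where
  zeros : ∀ {f : ℕ → ℕ} → (∀ j → f (suc j) ≤ f j) → f 0 ≡ 0 → ∀ j → f j ≡ 0
  zeros dec f0 zero    = f0
  zeros dec f0 (suc j) = n≤0⇒n≡0 (≤-trans (dec j) (≤-reflexive (zeros dec f0 j)))
  go : ∀ f n → (∀ j → f (suc j) ≤ f j) → f n ≡ 0 → ∀ j → nth 0 (filter (1 ≤?_) (applyUpTo f n)) j ≡ f j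
  go f zero    dec fn j = sym (zeros dec fn j)
  go f (suc n) dec fn j with 1 ≤? f 0
  ... | no ¬p = trans
    (cong (λ xs → nth 0 xs j) (trans (List.filter-reject (1 ≤?_) ¬p)
      (List.filter-none (1 ≤?_) (All.applyUpTo⁺₂ (f ∘ suc) n λ i → <⇒≱ (s≤s (≤-reflexive (f≡0 (suc i))))))))
    (sym (f≡0 j))
    where f≡0 = zeros dec (n≤0⇒n≡0 (≤-pred (≰⇒> ¬p)))
  go f (suc n) dec fn zero    | yes p = cong (λ xs → nth 0 xs 0) (List.filter-accept (1 ≤?_) p)
  go f (suc n) dec fn (suc j) | yes p =
    trans (cong (λ xs → nth 0 xs (suc j)) (List.filter-accept (1 ≤?_) p)) (go (f ∘ suc) n (dec ∘ suc) fn j)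

-- On row lengths of ν: removing one box from every row of α leaves a horizontal strip over ν,
-- and β/ν is a vertical strip.
Admissible : Partition → Partition → (ℕ → ℕ) → Set
Admissible α β f = ∀ j →
  (f j ≤ pred (part α j) × part α (suc j) ≤ suc (f j)) × (f j ≤ part β j × part β j ≤ suc (f j))

sgn-suc : ∀ n → -1ℤ ℤ.^ suc n ≡ - (-1ℤ ℤ.^ n)
sgn-suc n = ℤ.-1*i≡-i (-1ℤ ℤ.^ n)

-- The two kinds of elements, and why ν determines each.

module _ {k n : ℕ} {α β : Partition} where

  private
    X = X′ (suc k) n α β k

  -- Empty content is treated as a column of height 0, so both fillings are instances of `colWords`.
  record IsEmpty (χ : X) : Set where
    field
      μ≡     : parts (μ χ) ≡ []
      left≡  : rows (tableau (left χ)) ≡ colWords 0 (rowLengths α (ν χ))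
      right≡ : rows (tableau (right χ)) ≡ colWords 0 (rowLengths β (ν χ))
      sizeα  : sum (rowLengths α (ν χ)) ≡ 0
      sizeβ  : sum (rowLengths β (ν χ)) ≡ 0

  record IsRow (χ : X) : Set where
    field
      a          : ℕ
      μ≡         : parts (μ χ) ≡ [ suc a ]
      left≡      : rows (tableau (left χ)) ≡ map reverse (hookWords 0 (rowLengths α (ν χ)))
      right≡     : rows (tableau (right χ)) ≡ colWords 0 (rowLengths β (ν χ))
      ℓ≡         : ℓ α ≡ suc k
      sizeα      : suc a + k ≡ sum (rowLengths α (ν χ))
      sizeβ      : sum (rowLengths β (ν χ)) ≡ suc a + k
      admissible : Admissible α β (part (ν χ))

  IsEmpty⇒ν≡α : ∀ {χ} → IsEmpty χ → ν χ ≡ α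
  IsEmpty⇒ν≡α {χ} e = rowLengths-empty α (ν χ) (LR-contained (left χ)) (IsEmpty.sizeα e)

  IsEmpty⇒ν≡β : ∀ {χ} → IsEmpty χ → ν χ ≡ β
  IsEmpty⇒ν≡β {χ} e = rowLengths-empty β (ν χ) (LR-contained (right χ)) (IsEmpty.sizeβ e)

  -- The a + 1 + k boxes of the vertical strip β/ν lie in different rows of β.
  IsRow⇒≤ℓβ : ∀ {χ} (r : IsRow χ) → suc (IsRow.a r) + k ≤ ℓ β
  IsRow⇒≤ℓβ {χ} r = ≤-trans (≤-reflexive (sym (IsRow.sizeβ r)))
    (≤-trans (sum≤length (vertical⇒rowLengths≤1 β (ν χ) λ j → proj₂ (proj₂ (IsRow.admissible r j))))
      (≤-reflexive (length-rowLengths β (ν χ))))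

  -- This ties the parity of |μ| to that of |ν|, so that signs can be compared through ν.
  IsRow-size : ∀ {χ} → IsRow χ → ∣ μ χ ∣ + (k + ∣ ν χ ∣) ≡ ∣ α ∣
  IsRow-size {χ} r = begin
    ∣ μ χ ∣ + (k + ∣ ν χ ∣)                 ≡⟨ cong (λ xs → sum xs + (k + ∣ ν χ ∣)) (IsRow.μ≡ r) ⟩
    suc a + 0 + (k + ∣ ν χ ∣)               ≡⟨ cong (_+ (k + ∣ ν χ ∣)) (+-identityʳ (suc a)) ⟩
    suc a + (k + ∣ ν χ ∣)                   ≡⟨ +-assoc (suc a) k _ ⟨
    suc a + k + ∣ ν χ ∣                     ≡⟨ cong (_+ ∣ ν χ ∣) (IsRow.sizeα r) ⟩
    sum (rowLengths α (ν χ)) + ∣ ν χ ∣      ≡⟨ sum-rowLengths α (ν χ) (LR-contained (left χ)) ⟩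
    ∣ α ∣                                   ∎
    where
    open ≡-Reasoning
    a = IsRow.a r

  ¬IsEmpty×IsRow : ∀ {χ} → IsEmpty χ → ¬ IsRow χ
  ¬IsEmpty×IsRow e r = contradiction (trans (sym (IsEmpty.μ≡ e)) (IsRow.μ≡ r)) λ ()

  module _ (ℓα≤ : ℓ α ≤ suc k) where

    abstract
      view : (χ : X) → IsEmpty χ ⊎ IsRow χ
      -- Since m = k + 1, the partition μ has at most m - k = 1 row.
      view χ@(mkX′ μ ν fits L R) with single-row μ (subst (ℓ μ ≤_) (m+n∸n≡m 1 k) (proj₁ fits))
      ... | inj₁ μ≡ = inj₁ record
        { μ≡     = μ≡
        ; left≡  = columnLR-rows lamα L
        ; right≡ = columnLR-rows lamβ R
        ; sizeα  = columnLR-size lamα L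
        ; sizeβ  = columnLR-size lamβ R
        }
        where
        lamα : parts (stabilize k μ) ≡ replicate 0 1
        lamα = stabilize-∅ k μ μ≡
        lamβ : parts (stabilize k (conjugate μ)) ≡ replicate 0 1
        lamβ = stabilize-∅ k (conjugate μ) (conjugate-∅ μ μ≡)
      ... | inj₂ (a , μ≡) = inj₂ record
        { a          = a
        ; μ≡         = μ≡
        ; left≡      = hookLR-rows lamα ℓα≤ L
        ; right≡     = columnLR-rows lamβ R
        ; ℓ≡         = hookLR-ℓ lamα ℓα≤ L
        ; sizeα      = hookLR-size lamα ℓα≤ L
        ; sizeβ      = columnLR-size lamβ R
        ; admissible = λ j → hookLR-horizontal lamα ℓα≤ L j , LR-contained R j , columnLR-strip lamβ R j
        }
        where
        lamα : parts (stabilize k μ) ≡ suc a ∷ replicate k 1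
        lamα = stabilize-row k μ μ≡
        lamβ : parts (stabilize k (conjugate μ)) ≡ replicate (suc a + k) 1
        lamβ = stabilize-column k (conjugate μ) (conjugate-row μ μ≡)

    -- The size of α/ν is 0 for an empty μ and a + 1 + k otherwise, so ν fixes the kind of element
    -- and a. Both fillings are given by formulas in ν.
    determined : (χ χ′ : X) → ν χ ≡ ν χ′ → χ ≡ χ′
    determined χ χ′ ν≡ with view χ | view χ′
    ... | inj₁ e | inj₁ e′ = X′-≡
      (Partition-≡ (trans (IsEmpty.μ≡ e) (sym (IsEmpty.μ≡ e′)))) ν≡
      (trans (IsEmpty.left≡ e) (trans (cong (colWords 0 ∘ rowLengths α) ν≡) (sym (IsEmpty.left≡ e′))))
      (trans (IsEmpty.right≡ e) (trans (cong (colWords 0 ∘ rowLengths β) ν≡) (sym (IsEmpty.right≡ e′))))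
    ... | inj₁ e | inj₂ r = contradiction
      (trans (sym (IsEmpty.sizeα e)) (trans (cong (sum ∘ rowLengths α) ν≡) (sym (IsRow.sizeα r)))) λ ()
    ... | inj₂ r | inj₁ e = contradiction
      (trans (sym (IsEmpty.sizeα e)) (trans (cong (sum ∘ rowLengths α) (sym ν≡)) (sym (IsRow.sizeα r)))) λ ()
    ... | inj₂ r | inj₂ r′ = X′-≡
      (Partition-≡ (trans (IsRow.μ≡ r) (trans (cong [_] a≡) (sym (IsRow.μ≡ r′))))) ν≡
      (trans (IsRow.left≡ r) (trans (cong (map reverse ∘ hookWords 0 ∘ rowLengths α) ν≡) (sym (IsRow.left≡ r′))))
      (trans (IsRow.right≡ r) (trans (cong (colWords 0 ∘ rowLengths β) ν≡) (sym (IsRow.right≡ r′))))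
      where
      a≡ : suc (IsRow.a r) ≡ suc (IsRow.a r′)
      a≡ = +-cancelʳ-≡ k _ _
        (trans (IsRow.sizeα r) (trans (cong (sum ∘ rowLengths α) ν≡) (sym (IsRow.sizeα r′))))

    -- As |μ| + k + |ν| = |α| for both elements, one more box in ν means one box less in μ.
    sgn-flip : ∀ {χ χ′ : X} → IsRow χ → IsRow χ′ → ∣ ν χ′ ∣ ≡ suc ∣ ν χ ∣ → sgn χ ≡ - sgn χ′
    sgn-flip {χ} {χ′} r r′ ν≡ = trans (cong (-1ℤ ℤ.^_) μ≡) (sgn-suc ∣ μ χ′ ∣)
      where
      open ≡-Reasoning
      μ≡ : ∣ μ χ ∣ ≡ suc ∣ μ χ′ ∣
      μ≡ = +-cancelʳ-≡ (k + ∣ ν χ ∣) _ _ (begin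
        ∣ μ χ ∣ + (k + ∣ ν χ ∣)        ≡⟨ IsRow-size r ⟩
        ∣ α ∣                          ≡⟨ IsRow-size r′ ⟨
        ∣ μ χ′ ∣ + (k + ∣ ν χ′ ∣)      ≡⟨ cong (λ s → ∣ μ χ′ ∣ + (k + s)) ν≡ ⟩
        ∣ μ χ′ ∣ + (k + suc ∣ ν χ ∣)   ≡⟨ cong (∣ μ χ′ ∣ +_) (+-suc k _) ⟩
        ∣ μ χ′ ∣ + suc (k + ∣ ν χ ∣)   ≡⟨ +-suc ∣ μ χ′ ∣ _ ⟩
        suc ∣ μ χ′ ∣ + (k + ∣ ν χ ∣)   ∎)

  -- Elements built from admissible row lengths.

  module _ (size≡ : ∣ α ∣ ≡ ∣ β ∣) (ℓβ≤ : ℓ β ≤ n) (ℓα≡ : ℓ α ≡ suc k)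
           (f : ℕ → ℕ) (admissible : Admissible α β f) where

    private
      f-antitone : ∀ j → f (suc j) ≤ f j
      -- Both sides are compared with `pred (part α (suc j))`.
      f-antitone j = ≤-trans (proj₁ (proj₁ (admissible (suc j)))) (pred-mono-≤ (proj₂ (proj₁ (admissible j))))

      f-ℓ : f (ℓ α) ≡ 0
      f-ℓ = n≤0⇒n≡0 (≤-trans (proj₁ (proj₁ (admissible (ℓ α)))) (≤-reflexive (cong pred (part-≥ℓ α ≤-refl))))

      ν₀ : Partition
      ν₀ = fromParts f (ℓ α) f-antitone

      part-ν₀ : ∀ j → part ν₀ j ≡ f j
      part-ν₀ = part-fromParts f-antitone f-ℓ

      admissible₀ : Admissible α β (part ν₀)
      admissible₀ j rewrite part-ν₀ j = admissible j

      horizontal : Horizontal α ν₀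
      horizontal = proj₁ ∘ admissible₀

      s = sum (rowLengths α ν₀)
      -- Each of the k + 1 rows of α has a box outside ν₀, so this subtraction is exact.
      a = s ∸ suc k

      sizeα : suc a + k ≡ s
      sizeα = trans (sym (+-suc a k)) (m∸n+n≡m (≤-trans
        (≤-reflexive (sym (trans (length-rowLengths α ν₀) ℓα≡)))
        (length≤sum (horizontal⇒1≤rowLengths α ν₀ horizontal))))

      sizeβ : suc a + k ≡ sum (rowLengths β ν₀)
      sizeβ = trans sizeα (+-cancelʳ-≡ ∣ ν₀ ∣ _ _ (trans
        (sum-rowLengths α ν₀ (λ j → ≤-trans (proj₁ (horizontal j)) pred[n]≤n))
        (trans size≡ (sym (sum-rowLengths β ν₀ (proj₁ ∘ proj₂ ∘ admissible₀))))))

      a+k≤n : suc a + k ≤ n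
      -- The vertical strip β/ν₀ has at most ℓ(β) boxes; this gives the column bound n - k on μ.
      a+k≤n = ≤-trans (≤-reflexive sizeβ)
        (≤-trans (sum≤length (vertical⇒rowLengths≤1 β ν₀ (proj₂ ∘ proj₂ ∘ admissible₀)))
          (≤-trans (≤-reflexive (length-rowLengths β ν₀)) ℓβ≤))

      row : Partition
      row = mkPartition [ suc a ] [-] (s≤s z≤n ∷ [])

    abstract
      rowElement : X
      rowElement = mkX′ row ν₀
        (≤-reflexive (sym (m+n∸n≡m 1 k)) , m+n≤o⇒m≤o∸n (suc a) a+k≤n)
        (hookLR (stabilize-row k row refl) ℓα≡ horizontal sizeα)
        (columnLR (proj₁ ∘ proj₂ ∘ admissible₀) (proj₂ ∘ proj₂ ∘ admissible₀)
          (trans (stabilize-column k (conjugate row) (conjugate-row row refl))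
            (cong (λ p → replicate p 1) sizeβ)))

      rowElement-ν : ∀ j → part (ν rowElement) j ≡ f j
      rowElement-ν = part-ν₀

      rowElement-IsRow : IsRow rowElement
      rowElement-IsRow =
        [ (λ e → contradiction (IsEmpty.μ≡ e) λ ()) , id ]′ (view (≤-reflexive ℓα≡) rowElement)

-- The case α ≢ β

-- The last row in which α is longer than β: `above` refers to greater indices, hence to lower rows.
record Pivot (α β : Partition) : Set where
  field
    i     : ℕ
    β<α   : part β i < part α i
    above : ∀ j → i < j → part α j ≤ part β j

-- If no row of α were longer, then α ⊆ β, and equal sizes would force α = β. Searching upwards from
-- below the diagram of α meets the last such row first.
pivot : ∀ {α β} → ∣ α ∣ ≡ ∣ β ∣ → α ≢ β → Pivot α β
pivot {α} {β} size≡ α≢β =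
  search (ℓ α) λ j ℓ≤j → ≤-trans (≤-reflexive (part-≥ℓ α ℓ≤j)) z≤n
  where
  α⊈β : ¬ α ⊆ β
  α⊈β α⊆β = α≢β (rowLengths-empty β α α⊆β
    (+-cancelʳ-≡ ∣ α ∣ _ 0 (trans (sum-rowLengths β α α⊆β) (sym size≡))))
  search : ∀ b → (∀ j → b ≤ j → part α j ≤ part β j) → Pivot α β
  search zero    above = contradiction (λ j → above j z≤n) α⊈β
  search (suc b) above with part β b <? part α b
  ... | yes β<α = record { i = b ; β<α = β<α ; above = above }
  ... | no  β≮α = search b λ j b≤j →
    [ above j , (λ { refl → ≮⇒≥ β≮α }) ]′ (m≤n⇒m<n∨m≡n b≤j)

-- Meant as the exchange of b and b - 1: the vertical strip condition allows only these values for
-- ν_i when b = β_i.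
switch : ℕ → ℕ → ℕ
switch b v with v ≟ b
... | yes _ = pred b
... | no  _ = b

toggle : ℕ → ℕ → (ℕ → ℕ) → ℕ → ℕ
toggle i b f j with j ≟ i
... | yes _ = switch b (f j)
... | no  _ = f j

toggle-at : ∀ i b f → toggle i b f i ≡ switch b (f i)
toggle-at i b f with i ≟ i
... | yes _  = refl
... | no i≢i = contradiction refl i≢i

toggle-off : ∀ i b f {j} → j ≢ i → toggle i b f j ≡ f j
toggle-off i b f {j} j≢i with j ≟ i
... | yes j≡i = contradiction j≡i j≢i
... | no  _   = refl

switch-≡ : ∀ b → switch b b ≡ pred b
switch-≡ b with b ≟ b
... | yes _  = refl
... | no b≢b = contradiction refl b≢b

switch-≢ : ∀ {b v} → v ≢ b → switch b v ≡ b
switch-≢ {b} {v} v≢b with v ≟ b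
... | yes v≡b = contradiction v≡b v≢b
... | no  _   = refl

data Switched (b v : ℕ) : Set where
  up   : b ≡ suc v → switch b v ≡ suc v → Switched b v
  down : v ≡ b → v ≡ suc (switch b v) → Switched b v

-- Positivity of b keeps b and `pred b` distinct, so the switch really moves v.
switched : ∀ {b v} → 1 ≤ b → v ≤ b → b ≤ suc v → Switched b v
switched {b@(suc _)} {v} _ v≤b b≤1+v with v ≟ b
... | yes refl = down refl (cong suc (sym (switch-≡ b)))
... | no  v≢b  = up b≡1+v (trans (switch-≢ v≢b) b≡1+v)
  where b≡1+v = ≤-antisym b≤1+v (≤∧≢⇒< v≤b v≢b)

switch-involutive : ∀ {b v} → Switched b v → switch b (switch b v) ≡ v
switch-involutive {b} {v} (up refl eq) rewrite eq = switch-≡ (suc v)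
switch-involutive {b} (down refl eq) = switch-≢ (<⇒≢ (≤-reflexive (sym eq)))

module _ {k n : ℕ} {α β : Partition} (size≡ : ∣ α ∣ ≡ ∣ β ∣) (ℓα≤ : ℓ α ≤ suc k) (ℓβ≤ : ℓ β ≤ n)
         (α≢β : α ≢ β) where

  private
    X = X′ (suc k) n α β k

    open Pivot (pivot size≡ α≢β)
    b = part β i

    isRow : (χ : X) → IsRow χ
    -- An empty μ would give α = ν = β.
    isRow χ = [ (λ (e : IsEmpty χ) → contradiction (trans (sym (IsEmpty⇒ν≡α e)) (IsEmpty⇒ν≡β e)) α≢β) , id ]′ (view ℓα≤ χ)

    i<ℓα : i < ℓ α
    i<ℓα with i <? ℓ α
    ... | yes p = p
    ... | no ¬p = contradiction (subst (part β i <_) (part-≥ℓ α (≮⇒≥ ¬p)) β<α) n≮0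

    -- β has at least a + k ≥ m rows, since β/ν is a vertical strip of that size.
    1≤b : X → 1 ≤ b
    1≤b χ = part-pos β (<-≤-trans i<ℓα (≤-trans ℓα≤ (≤-trans (s≤s (m≤n+m k _)) (IsRow⇒≤ℓβ (isRow χ)))))

    f : X → ℕ → ℕ
    f χ = toggle i b (part (ν χ))

    νi-switched : ∀ χ → Switched b (part (ν χ) i)
    νi-switched χ = switched (1≤b χ) (proj₁ β-bounds) (proj₂ β-bounds)
      where β-bounds = proj₂ (IsRow.admissible (isRow χ) i)

    -- α_{i+1} ≤ β_{i+1} ≤ β_i and β_i < α_i make both choices of ν_i admissible.
    f-admissible : ∀ χ → Admissible α β (f χ)
    f-admissible χ j with j ≟ i
    ... | no _ = IsRow.admissible (isRow χ) j
    ... | yes refl with νi-switched χ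
    ...   | up b≡ eq rewrite eq | sym b≡ =
      (pred-mono-≤ β<α , ≤-trans α≤b (n≤1+n b)) , ≤-refl , n≤1+n b
      where α≤b = ≤-trans (above (suc i) ≤-refl) (part-suc-≤ β i)
    ...   | down v≡b eq =
      (≤-trans switch≤b (pred-mono-≤ β<α) , ≤-trans α≤b b≤) , switch≤b , b≤
      where
      α≤b = ≤-trans (above (suc i) ≤-refl) (part-suc-≤ β i)
      b≤ = ≤-reflexive (trans (sym v≡b) eq)
      switch≤b = ≤-trans (n≤1+n _) (≤-reflexive (trans (sym eq) v≡b))

    -- Only ℓ(α) ≤ m is given in this case; the equality comes from the element itself.
    ℓα≡ : X → ℓ α ≡ suc k
    ℓα≡ χ = IsRow.ℓ≡ (isRow χ)

  toggleElement : X → X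
  toggleElement χ = rowElement size≡ ℓβ≤ (ℓα≡ χ) (f χ) (f-admissible χ)

  private
    toggled : ∀ χ j → part (ν (toggleElement χ)) j ≡ f χ j
    toggled χ = rowElement-ν {n = n} size≡ ℓβ≤ (ℓα≡ χ) (f χ) (f-admissible χ)

    toggled-at : ∀ χ → part (ν (toggleElement χ)) i ≡ switch b (part (ν χ) i)
    toggled-at χ = trans (toggled χ i) (toggle-at i b (part (ν χ)))

    toggled-off : ∀ χ j → j ≢ i → part (ν (toggleElement χ)) j ≡ part (ν χ) j
    toggled-off χ j j≢i = trans (toggled χ j) (toggle-off i b (part (ν χ)) j≢i)

  toggleElement-involutive : ∀ χ → toggleElement (toggleElement χ) ≡ χ
  toggleElement-involutive χ = determined ℓα≤ _ χ (part-injective ν≡)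
    where
    χ′ = toggleElement χ
    ν≡ : ∀ j → part (ν (toggleElement χ′)) j ≡ part (ν χ) j
    ν≡ j with j ≟ i
    ... | no  j≢i  = trans (toggled-off χ′ j j≢i) (toggled-off χ j j≢i)
    ... | yes refl = trans (toggled-at χ′)
      (trans (cong (switch b) (toggled-at χ)) (switch-involutive (νi-switched χ)))

  toggleElement-sgn : ∀ χ → sgn (toggleElement χ) ≡ - sgn χ
  toggleElement-sgn χ with νi-switched χ
  ... | down _ eq = sgn-flip ℓα≤ (isRow χ′) (isRow χ)
    (size-suc (ν χ′) (ν χ) i (trans eq (cong suc (sym (toggled-at χ)))) λ j j≢i → sym (toggled-off χ j j≢i))
    where χ′ = toggleElement χ
  -- The situation of the other case with the two elements exchanged, hence the double negation.
  ... | up _ eq = trans (sym (ℤ.neg-involutive _)) (cong -_ (sym (sgn-flip ℓα≤ (isRow χ) (isRow χ′)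
    (size-suc (ν χ) (ν χ′) i (trans (toggled-at χ) eq) (toggled-off χ)))))
    where χ′ = toggleElement χ

-- The case α ≡ β

module _ {k n : ℕ} {α : Partition} (ℓα≡ : ℓ α ≡ suc k) (ℓα≤ : ℓ α ≤ n) where

  private
    X = X′ (suc k) n α α k

    viewα = view {k} {n} {α} {α} (≤-reflexive ℓα≡)

    ∅ : Partition
    ∅ = mkPartition [] [] []

    size0 : 0 ≡ sum (rowLengths α α)
    size0 = +-cancelʳ-≡ ∣ α ∣ _ _ (sym (sum-rowLengths α α λ _ → ≤-refl))

    χ₀ : X
    χ₀ = mkX′ ∅ α (z≤n , z≤n) (column ∅ refl) (column (conjugate ∅) refl)
      where
      column : ∀ μ → parts μ ≡ [] → LR α α (stabilize k μ)
      column μ μ≡ = columnLR (λ _ → ≤-refl) (λ _ → n≤1+n _)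
        (trans (stabilize-∅ k μ μ≡) (cong (λ p → replicate p 1) size0))

    -- Here ν arises from α by removing the last box of every row.
    χ₁ : X
    χ₁ = rowElement refl ℓα≤ ℓα≡ (pred ∘ part α)
      (λ j → (≤-refl , ≤-trans (part-suc-≤ α j) suc-pred-≥) , pred[n]≤n , suc-pred-≥)
      where
      suc-pred-≥ : ∀ {m} → m ≤ suc (pred m)
      suc-pred-≥ {zero}  = z≤n
      suc-pred-≥ {suc m} = ≤-refl

    χ₀-isEmpty : IsEmpty χ₀
    χ₀-isEmpty = [ id , (λ r → contradiction (IsRow.μ≡ r) λ ()) ]′ (viewα χ₀)

    χ₁-isRow : IsRow χ₁
    χ₁-isRow = rowElement-IsRow _ _ ℓα≡ _ _

    IsEmpty⇒≡χ₀ : ∀ {χ : X} → IsEmpty χ → χ ≡ χ₀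
    IsEmpty⇒≡χ₀ {χ} e = determined (≤-reflexive ℓα≡) χ χ₀ (IsEmpty⇒ν≡α e)

    -- With α = β the hook bounds ν_j by α_j - 1 from above and the column bounds it by the same
    -- number from below, leaving one choice of ν.
    IsRow⇒≡χ₁ : ∀ {χ : X} → IsRow χ → χ ≡ χ₁
    IsRow⇒≡χ₁ {χ} r = determined (≤-reflexive ℓα≡) χ χ₁ (part-injective λ j →
      trans (ν≡ r j) (sym (ν≡ χ₁-isRow j)))
      where
      ν≡ : ∀ {χ : X} → IsRow χ → ∀ j → part (ν χ) j ≡ pred (part α j)
      ν≡ r j with IsRow.admissible r j
      ... | (ν≤ , _) , (_ , α≤) = ≤-antisym ν≤ (pred-mono-≤ α≤)

    -- The a + 1 + k boxes of the vertical strip must fit in the k + 1 rows of α, so a = 0.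
    IsRow⇒∣μ∣≡1 : ∀ {χ : X} → IsRow χ → ∣ μ χ ∣ ≡ 1
    IsRow⇒∣μ∣≡1 {χ} r = trans (cong sum (IsRow.μ≡ r)) (cong (λ a → suc a + 0)
      (n≤0⇒n≡0 (+-cancelʳ-≤ k (IsRow.a r) 0 (≤-pred (≤-trans (IsRow⇒≤ℓβ {χ = χ} r) (≤-reflexive ℓα≡))))))

  swapElements : X → X
  swapElements χ = [ const χ₁ , const χ₀ ]′ (viewα χ)

  private
    swap-empty : ∀ {χ : X} → IsEmpty χ → swapElements χ ≡ χ₁
    swap-empty {χ} e with viewα χ
    ... | inj₁ _ = refl
    ... | inj₂ r = contradiction r (¬IsEmpty×IsRow e)

    swap-row : ∀ {χ : X} → IsRow χ → swapElements χ ≡ χ₀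
    swap-row {χ} r with viewα χ
    ... | inj₁ e = contradiction r (¬IsEmpty×IsRow e)
    ... | inj₂ _ = refl

  swapElements-involutive : ∀ χ → swapElements (swapElements χ) ≡ χ
  swapElements-involutive χ with viewα χ
  ... | inj₁ e = trans (swap-row χ₁-isRow) (sym (IsEmpty⇒≡χ₀ e))
  ... | inj₂ r = trans (swap-empty χ₀-isEmpty) (sym (IsRow⇒≡χ₁ r))

  swapElements-sgn : ∀ χ → sgn (swapElements χ) ≡ - sgn χ
  swapElements-sgn χ with viewα χ
  ... | inj₁ e = trans (cong (-1ℤ ℤ.^_) (IsRow⇒∣μ∣≡1 {χ₁} χ₁-isRow))
    (cong (λ xs → - (-1ℤ ℤ.^ sum xs)) (sym (IsEmpty.μ≡ e)))
  ... | inj₂ r = cong (λ s → - (-1ℤ ℤ.^ s)) (sym (IsRow⇒∣μ∣≡1 {χ} r))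

theorem5p8 : (m n : ℕ) → 1 ≤ m → m ≤ n →
    (α β : Partition) → ∣ α ∣ ≡ ∣ β ∣ → ℓ α ≤ m → ℓ β ≤ n →
    (α ≢ β) ⊎ (α ≡ β × ℓ α ≡ m) →
    Σ[ φ ∈ (X′ m n α β (m ∸ 1) → X′ m n α β (m ∸ 1)) ]
    ((∀ χ → φ (φ χ) ≡ χ) × (∀ χ → sgn (φ χ) ≡ - sgn χ))
theorem5p8 (suc k) n _ _ α β size≡ ℓα≤ ℓβ≤ (inj₁ α≢β) =
  toggleElement size≡ ℓα≤ ℓβ≤ α≢β , toggleElement-involutive size≡ ℓα≤ ℓβ≤ α≢β , toggleElement-sgn size≡ ℓα≤ ℓβ≤ α≢β
theorem5p8 (suc k) n _ _ α .α _ _ ℓα≤ (inj₂ (refl , ℓα≡)) =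
  swapElements ℓα≡ ℓα≤ , swapElements-involutive ℓα≡ ℓα≤ , swapElements-sgn ℓα≡ ℓα≤
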